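{- For the offline submodular bin packing problem (SMBP) with $N$ jobs, the algorithm Local-Search terminates after at most $N^3$ operations, and purchases at most $2\,\mathrm{OPT}+11$ machines, where $\mathrm{OPT}$ is the minimum number of machines needed to serve all the jobs.
   Context: Submodular bin packing (SMBP): each job $j\in\{1,\dots,N\}$ has two parameters $\mu_j\ge 0$ and $b_j\ge 0$. All machines have the same capacity $V>0$, and $D=D(\alpha)\ge 0$ is a given constant. A set $S$ of jobs is feasible (can be assigned to one machine) if $\sum_{j\in S}\mu_j + D\sqrt{\sum_{j\in S} b_j}\le V$. Every job must be assigned to exactly one machine, the set of jobs on each machine must be feasible, and the goal is to minimize the number of machines used. Every single job is assumed feasible on its own. (By rescaling one may equivalently take $V=1$ and $D=1$.) In the offline version all jobs are known in advance. A job fits in a machine if adding it to the machine's current set of jobs keeps that set feasible. Algorithm Local-Search. Each machine has a unique identifier number. The algorithm starts from an arbitrary feasible assignment of all jobs to machines and then repeatedly applies any available update operation from the list below, until none is available. A machine left with no jobs is released (no longer counted as purchased). At any time let: $A_1$ be the set of machines containing exactly one job and $S_1$ the set of jobs assigned to machines of $A_1$; a job $j\notin S_1$ is good if it fits in at least $6$ of the machines in $A_1$; a machine is large if it contains at least $5$ jobs, and medium size if it contains $2$, $3$ or $4$ jobs; a medium size machine is critical if it contains one job that fits in none of the machines in $A_1$ and all its other jobs are good. The update operations are: (1) Find a job $j$ in a machine with identifier $i$ that fits in some other purchased machine with identifier $i'<i$, and move $j$ to machine $i'$. (2) Find a medium size machine $i$ that contains only good jobs. Assign its jobs (at most $4$)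 one after the other to pairwise distinct machines of $A_1$ in which they fit (possible since each fits in at least $6$ of them; choices are arbitrary), and release machine $i$. (3) Find a medium size machine $i$ that contains one job $j$ that fits in at least one machine in $A_1$, while the rest of the jobs in $i$ are all good. Assign $j$ to a machine of $A_1$ in which it fits, assign the other jobs to further, pairwise distinct machines of $A_1$ in which they fit, and release machine $i$. (4) Find two critical machines $i_1$ and $i_2$ such that, with $j_1$ and $j_2$ denoting the jobs in $i_1$ and $i_2$ respectively that fit in no machine of $A_1$, the set $\{j_1,j_2\}$ is feasible. Purchase a new machine and assign $j_1$ and $j_2$ to it; assign all the remaining (at most $6$, all good) jobs of $i_1$ and $i_2$ to pairwise distinct machines of $A_1$ in which they fit; release machines $i_1$ and $i_2$. (If $\{j_1,j_2\}$ is not feasible, nothing is done and this does not count as an available operation.) -}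

module Defs where

open import Algebra.Apartness.Bundles using (HeytingField; HeytingCommutativeRing)
open import Algebra.Bundles using (CommutativeRing)
import Algebra.Properties.CommutativeMonoid.Sum as Sum
open import Data.Bool.Base using (if_then_else_)
open import Data.Fin.Base using (Fin)
open import Data.Fin.Subset using (Subset; ⁅_⁆; _∪_; ∣_∣)
open import Data.List.Base using (length; deduplicate; tabulate)
open import Data.Nat.Base as ℕ using (ℕ; zero; suc)
import Data.Nat.Properties as ℕ
open import Data.Product.Base using (Σ; _×_; ∃-syntax)
open import Data.Sum.Base using (_⊎_)
import Data.Vec.Base as Vec
open import Data.Vec.Functional using (Vector)
open import Function.Bundles using (_⇔_; _↣_; module Injection)
open import Level using (_⊔_) renaming (suc to lsuc)
open import Relation.Binary.Core using (Rel)
open import Relation.Binary.PropositionalEquality.Core using (_≡_; _≢_)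
open import Relation.Binary.Structures using (IsStrictPartialOrder)
open import Relation.Nullary.Decidable.Core using (does)
open import Relation.Nullary.Negation.Core using (¬_)

-- Ordered fields in which nonnegative elements have square roots.  The real
-- numbers are the intended model.  Neither decidability nor totality of the
-- order is demanded, so that besides the classical reals also constructive
-- reals qualify; in the presence of excluded middle these are exactly the
-- Euclidean (totally) ordered fields.
record EuclideanField c ℓ₁ ℓ₂ ℓ₃ : Set (lsuc (c ⊔ ℓ₁ ⊔ ℓ₂ ⊔ ℓ₃)) where
  field
    heytingField : HeytingField c ℓ₁ ℓ₂

  open HeytingField heytingField public

  infix 4 _<_ _≤_
  infix 9 √_

  field
    _<_                  : Rel Carrier ℓ₃
    isStrictPartialOrder : IsStrictPartialOrder _≈_ _<_
    #⇔<⊎>                : ∀ {x y} → x # y ⇔ (x < y ⊎ y < x)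
    +-monoˡ-<            : ∀ {x y} z → x < y → x + z < y + z
    *-pos                : ∀ {x y} → 0# < x → 0# < y → 0# < x * y

  _≤_ : Rel Carrier ℓ₃
  x ≤ y = ¬ (y < x)

  -- √ is total for convenience; it is only specified on nonnegative elements.
  field
    √_       : Carrier → Carrier
    √-cong   : ∀ {x y} → x ≈ y → √ x ≈ √ y
    √-nonneg : ∀ {x} → 0# ≤ x → 0# ≤ √ x
    √-square : ∀ {x} → 0# ≤ x → √ x * √ x ≈ x

  commutativeRing : CommutativeRing c ℓ₁
  commutativeRing = HeytingCommutativeRing.commutativeRing heytingCommutativeRing

  open Sum (CommutativeRing.+-commutativeMonoid commutativeRing) public
    using (sum)

  ∑∈ : ∀ {n} → Subset n → Vector Carrier n → Carrier
  ∑∈ S f = sum (λ j → if Vec.lookup S j then f j else 0#)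

record SMBP {c ℓ₁ ℓ₂ ℓ₃} (F : EuclideanField c ℓ₁ ℓ₂ ℓ₃) (N : ℕ)
       : Set (c ⊔ ℓ₃) where
  open EuclideanField F

  field
    μ b      : Vector Carrier N
    V D      : Carrier
    μ-nonneg : ∀ j → 0# ≤ μ j
    b-nonneg : ∀ j → 0# ≤ b j
    V-pos    : 0# < V
    D-nonneg : 0# ≤ D

  Feasible : Subset N → Set ℓ₃
  Feasible S = ∑∈ S μ + D * √ (∑∈ S b) ≤ V

  field
    singleton-feasible : ∀ j → Feasible ⁅ j ⁆

module LocalSearch {c ℓ₁ ℓ₂ ℓ₃} {F : EuclideanField c ℓ₁ ℓ₂ ℓ₃} {N : ℕ}
                   (I : SMBP F N) where
  open SMBP I using (Feasible)

  -- σ j is the identifier of the machine of job j.  The purchased machines are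
  -- the identifiers in the image of σ, so a machine left without jobs is
  -- automatically released.
  Assignment : Set
  Assignment = Vector ℕ N

  jobs : Assignment → ℕ → Subset N
  jobs σ i = Vec.tabulate (λ j → does (σ j ℕ.≟ i))

  Purchased : Assignment → ℕ → Set
  Purchased σ i = ∃[ j ] σ j ≡ i

  FeasibleAssignment : Assignment → Set ℓ₃
  FeasibleAssignment σ = ∀ i → Purchased σ i → Feasible (jobs σ i)

  #machines : Assignment → ℕ
  #machines σ = length (deduplicate ℕ._≟_ (tabulate σ))

  IsOPT : ℕ → Set ℓ₃
  IsOPT m = (∃[ σ ] FeasibleAssignment σ × #machines σ ≡ m)
          × (∀ σ → FeasibleAssignment σ → m ℕ.≤ #machines σ)

  Fits : Assignment → Fin N → ℕ → Set ℓ₃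
  Fits σ j i = Feasible (jobs σ i ∪ ⁅ j ⁆)

  -- The set A₁; S₁ consists of the jobs j with A₁ σ (σ j).
  A₁ : Assignment → ℕ → Set
  A₁ σ i = ∣ jobs σ i ∣ ≡ 1

  Medium : Assignment → ℕ → Set
  Medium σ i = 2 ℕ.≤ ∣ jobs σ i ∣ × ∣ jobs σ i ∣ ℕ.≤ 4

  Good : Assignment → Fin N → Set ℓ₃
  Good σ j = ¬ A₁ σ (σ j)
           × Σ (Fin 6 ↣ ℕ) λ f → ∀ k →
               A₁ σ (Injection.to f k) × Fits σ j (Injection.to f k)

  FitsSomeA₁ : Assignment → Fin N → Set ℓ₃
  FitsSomeA₁ σ j = ∃[ i ] A₁ σ i × Fits σ j i

  OthersGood : Assignment → ℕ → Fin N → Set ℓ₃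
  OthersGood σ i j = ∀ k → σ k ≡ i → k ≢ j → Good σ k

  -- Machine i is critical, and j is its job that fits in no machine of A₁.
  CriticalVia : Assignment → ℕ → Fin N → Set ℓ₃
  CriticalVia σ i j =
    Medium σ i × σ j ≡ i × ¬ FitsSomeA₁ σ j × OthersGood σ i j

  -- In τ, the jobs satisfying P sit on pairwise distinct machines that belong
  -- to A₁, and accommodate them, with respect to σ.
  Spread : ∀ {p} → Assignment → Assignment → (Fin N → Set p) → Set (p ⊔ ℓ₃)
  Spread σ τ P =
      (∀ j → P j → A₁ σ (τ j) × Fits σ j (τ j))
    × (∀ j k → P j → P k → τ j ≡ τ k → j ≡ k)

  Unchanged : ∀ {p} → Assignment → Assignment → (Fin N → Set p) → Set p
  Unchanged σ τ P = ∀ j → P j → τ j ≡ σ j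

  data Step (σ τ : Assignment) : Set ℓ₃ where
    op₁ : ∀ j i → Purchased σ i → i ℕ.< σ j → Fits σ j i →
          τ j ≡ i →
          Unchanged σ τ (λ k → k ≢ j) →
          Step σ τ

    op₂ : ∀ i → Medium σ i → (∀ j → σ j ≡ i → Good σ j) →
          Spread σ τ (λ k → σ k ≡ i) →
          Unchanged σ τ (λ k → σ k ≢ i) →
          Step σ τ

    op₃ : ∀ i j → Medium σ i → σ j ≡ i → FitsSomeA₁ σ j → OthersGood σ i j →
          Spread σ τ (λ k → σ k ≡ i) →
          Unchanged σ τ (λ k → σ k ≢ i) →
          Step σ τ

    -- new may be any identifier that is not in use.
    op₄ : ∀ i₁ i₂ j₁ j₂ new → i₁ ≢ i₂ →
          CriticalVia σ i₁ j₁ → CriticalVia σ i₂ j₂ →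
          Feasible (⁅ j₁ ⁆ ∪ ⁅ j₂ ⁆) →
          ¬ Purchased σ new → τ j₁ ≡ new → τ j₂ ≡ new →
          Spread σ τ (λ k → (σ k ≡ i₁ ⊎ σ k ≡ i₂) × k ≢ j₁ × k ≢ j₂) →
          Unchanged σ τ (λ k → σ k ≢ i₁ × σ k ≢ i₂) →
          Step σ τ

  -- Run n σ τ: n successive operations lead from σ to τ.
  data Run : ℕ → Assignment → Assignment → Set ℓ₃ where
    []  : ∀ {σ} → Run zero σ σ
    _∷_ : ∀ {n σ τ ρ} → Step σ τ → Run n τ ρ → Run (suc n) σ ρ

  Terminal : Assignment → Set ℓ₃
  Terminal σ = ∀ τ → ¬ Step σ τ

{-# OPTIONS --safe #-}
module Submission where

-- Termination: the number of machines never grows, and it drops at every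
-- operation other than (1), while (1) lowers the sum of the ranks of the jobs'
-- machines among the purchased ones.  The latter is at most N².
--
-- Quality: the square root is linearised by the weight V μ + D² b, in units
-- with V² = 1.  A feasible set weighs at most 1 and an infeasible one at least
-- ¾.  Count the machines of a terminal assignment: a with one job, c critical,
-- m other medium and l large ones.  The jobs in A₁ and those that make a
-- machine critical are pairwise incompatible, so a + c ≤ OPT.  By (1), of any
-- two machines with at least k jobs one weighs at least ¾ k / (k + 1), so that
-- up to one exception in each class, critical and medium machines weigh at
-- least ½ and large ones at least ⅝.  By (2) and (3), a noncritical medium
-- machine has two jobs that are not good; if x is the least weight of such a
-- job, all machines of A₁ but five weigh at least s = ¾ - x, and the medium
-- machines in question at least 2 x = 3/2 - 2 s.  For 3/8 ≤ s ≤ ½ the claim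
-- follows from (1 - 2 s)(a + c) ≤ (1 - 2 s) OPT together with the bound OPT on
-- the total weight, and outside this range s may be replaced by the nearer
-- endpoint.

open import Defs
import Algebra.Apartness.Properties.HeytingCommutativeRing as HeytingProperties
open import Algebra.Bundles using (CommutativeRing)
import Algebra.Properties.AbelianGroup as AbelianGroupProperties
import Algebra.Properties.CommutativeMonoid.Mult as Mult
import Algebra.Properties.CommutativeMonoid.Sum as Sum
import Algebra.Properties.CommutativeSemigroup as CommutativeSemigroupProperties
import Algebra.Solver.Ring.NaturalCoefficients.Default as SemiringSolver
open import Data.Bool.Base using (T; true; false; _∨_; if_then_else_)
import Data.Empty as Empty
open import Data.Fin.Base using (Fin; zero; suc)
open import Data.Fin.Properties as Fin using (any?; sequence)
open import Data.Fin.Subset using (Subset; ⊥; _∪_; ⁅_⁆; ∣_∣; _⊆_; Nonempty; inside; outside)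
  renaming (_∈_ to _∈ₛ_)
import Data.Fin.Subset.Properties as Subset
open import Data.List.Base as List using (List; []; _∷_; _++_; length; filter; tabulate; allFin; deduplicate; [_])
open import Data.List.Extrema.Nat using (max; xs≤max)
open import Data.List.Membership.Propositional using (_∈_; _∉_)
open import Data.List.Membership.Propositional.Properties
  using ( ∈-∃++; ∈-++⁺ˡ; ∈-++⁺ʳ; ∈-++⁻; ∈-tabulate⁺; ∈-tabulate⁻; ∈-filter⁺; ∈-filter⁻
        ; ∈-deduplicate⁺; ∈-deduplicate⁻; ∈-allFin; ∈-lookup; ∈-length)
open import Data.List.Properties using (length-++; length-tabulate; length-deduplicate)
open import Data.List.Relation.Unary.All as All using (All; []; _∷_)
open import Data.List.Relation.Unary.All.Properties using (¬Any⇒All¬; All¬⇒¬Any)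
open import Data.List.Relation.Unary.AllPairs using ([]; _∷_)
open import Data.List.Relation.Unary.Any using (here; there)
open import Data.List.Relation.Unary.Unique.Propositional using (Unique)
import Data.List.Relation.Unary.Unique.Propositional.Properties as Unique
open import Data.Nat.Base as ℕ using (ℕ; zero; suc; z≤n; s≤s)
open import Data.Nat.ListAction using (sum)
import Data.Nat.Properties as ℕ
open import Data.Nat.Solver using (module +-*-Solver)
open import Data.List.Membership.DecPropositional ℕ._≟_ using (_∈?_)
open import Data.List.Relation.Unary.Unique.DecPropositional.Properties ℕ._≟_ using (deduplicate-!)
open import Data.Product.Base using (_×_; ∃-syntax; _,_; proj₁; proj₂; uncurry)
open import Data.Sum.Base using (_⊎_; inj₁; inj₂; [_,_]′)
open import Data.Vec.Base as Vec using ([]; _∷_)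
open import Data.Vec.Functional using (Vector; updateAt)
open import Data.Vec.Functional.Properties using (updateAt-updates; updateAt-minimal)
import Data.Vec.Properties as Vec
open import Effect.Monad using (RawMonad)
open import Function.Base using (_∘_; id; const)
open import Function.Bundles using (_↣_; module Equivalence; module Injection; mk↣)
open import Level using (Level; _⊔_)
open import Relation.Binary.Bundles using (Preorder)
open import Relation.Binary.Definitions using (tri<; tri≈; tri>)
open import Relation.Binary.PropositionalEquality as ≡ using (_≡_; _≢_)
import Relation.Binary.Reasoning.Preorder as PreorderReasoning
open import Relation.Binary.Structures using (IsStrictPartialOrder)
open import Relation.Nullary.Decidable
  using (Dec; yes; no; does; ¬?; _×-dec_; _⊎-dec_; dec-true; dec-false; decidable-stable; ¬¬-excluded-middle)
open import Relation.Nullary.Negation using (¬_; contradiction; ¬¬-Monad)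
open import Relation.Unary using (Pred; Decidable)

-- The order of the field is undecidable, but a ≤ is a negation.
by-cases : ∀ {a p} (A : Set a) {P : Set p} → (A → ¬ P) → (¬ A → ¬ P) → ¬ P
by-cases A f g p = g (λ a → f a p) p

-- Constructive order arithmetic and sums over subsets in a Euclidean field.

module EuclideanFieldProperties {c ℓ₁ ℓ₂ ℓ₃} (F : EuclideanField c ℓ₁ ℓ₂ ℓ₃) where
  open EuclideanField F public hiding (zero)
  open CommutativeRing commutativeRing public
    using (+-commutativeMonoid; +-abelianGroup; +-commutativeSemigroup; commutativeSemiring)
  open HeytingProperties heytingCommutativeRing using (invertibleˡ⇒#)
  open Mult +-commutativeMonoid public
    using (×-homo-+; ×-assocˡ; ×-distrib-+; ×-congʳ)
    renaming (_×_ to infixl 8 _·_)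
  open AbelianGroupProperties +-abelianGroup using (//-rightDividesˡ)
  open AbelianGroupProperties +-abelianGroup public using ()
    renaming (∙-cancelʳ to +-cancelʳ)
  open CommutativeSemigroupProperties +-commutativeSemigroup public using (interchange)
  open IsStrictPartialOrder isStrictPartialOrder public
    using (<-respˡ-≈; <-respʳ-≈)
    renaming (irrefl to <-irrefl; trans to <-trans; asym to <-asym)

  module Solver where
    open SemiringSolver commutativeSemiring public

    infixl 8 _:·_
    -- Iterated addition mirrors the recursion of `_·_`, so that solved equations have the shape of
    -- the goals.
    _:·_ : ∀ {k} → ℕ → Polynomial k → Polynomial k
    zero  :· e = con 0
    suc n :· e = e :+ n :· e

  private variable
    x y z u v : Carrier

  <⇒# : x < y → x # y
  <⇒# = Equivalence.from #⇔<⊎> ∘ inj₁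

  #⇒<⊎> : x # y → x < y ⊎ y < x
  #⇒<⊎> = Equivalence.to #⇔<⊎>

  <-cotrans : x < y → ∀ z → x < z ⊎ z < y
  <-cotrans x<y z with #-cotrans (<⇒# x<y) z
  ... | inj₁ x#z = [ inj₁ , (λ z<x → inj₂ (<-trans z<x x<y)) ]′ (#⇒<⊎> x#z)
  ... | inj₂ z#y = [ inj₂ , (λ y<z → inj₁ (<-trans x<y y<z)) ]′ (#⇒<⊎> z#y)

  <⇒≤ : x < y → x ≤ y
  <⇒≤ = <-asym

  ≤-reflexive : x ≈ y → x ≤ y
  ≤-reflexive x≈y = <-irrefl (sym x≈y)

  ≤-refl : x ≤ x
  ≤-refl = ≤-reflexive refl

  ≤-trans : x ≤ y → y ≤ z → x ≤ z
  ≤-trans {y = y} x≤y y≤z z<x = [ y≤z , x≤y ]′ (<-cotrans z<x y)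

  ≤-preorder : Preorder c ℓ₁ ℓ₃
  ≤-preorder = record
    { isPreorder = record
      { isEquivalence = isEquivalence
      ; reflexive     = ≤-reflexive
      ; trans         = ≤-trans
      }
    }

  module ≤-Reasoning = PreorderReasoning ≤-preorder

  ≤-<-trans : x ≤ y → y < z → x < z
  ≤-<-trans {x = x} x≤y y<z = [ (λ y<x → contradiction y<x x≤y) , id ]′ (<-cotrans y<z x)

  private
    cancel : ∀ x z → x + z + - z ≈ x
    cancel x z = trans (+-assoc x z (- z)) (trans (+-congˡ (-‿inverseʳ z)) (+-identityʳ x))

  +-cancelʳ-< : ∀ z → x + z < y + z → x < y
  +-cancelʳ-< {x} {y} z =
    <-respˡ-≈ (cancel x z) ∘ <-respʳ-≈ (cancel y z) ∘ +-monoˡ-< (- z)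

  +-monoˡ-≤ : ∀ z → x ≤ y → x + z ≤ y + z
  +-monoˡ-≤ z x≤y = x≤y ∘ +-cancelʳ-< z

  +-monoʳ-≤ : ∀ z → x ≤ y → z + x ≤ z + y
  +-monoʳ-≤ {x} {y} z x≤y = begin
    z + x ≈⟨ +-comm z x ⟩
    x + z ≲⟨ +-monoˡ-≤ z x≤y ⟩
    y + z ≈⟨ +-comm y z ⟩
    z + y ∎
    where open ≤-Reasoning

  +-mono-≤ : x ≤ y → u ≤ v → x + u ≤ y + v
  +-mono-≤ x≤y u≤v = ≤-trans (+-monoˡ-≤ _ x≤y) (+-monoʳ-≤ _ u≤v)

  +-cancelʳ-≤ : ∀ z → x + z ≤ y + z → x ≤ y
  +-cancelʳ-≤ z x+z≤y+z = x+z≤y+z ∘ +-monoˡ-< z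

  x≤x+y : 0# ≤ y → x ≤ x + y
  x≤x+y {y} {x} 0≤y = ≤-trans (≤-reflexive (sym (+-identityʳ x))) (+-monoʳ-≤ x 0≤y)

  x≤y+x : 0# ≤ y → x ≤ y + x
  x≤y+x 0≤y = ≤-trans (x≤x+y 0≤y) (≤-reflexive (+-comm _ _))

  +-nonneg : 0# ≤ x → 0# ≤ y → 0# ≤ x + y
  +-nonneg 0≤x 0≤y = ≤-trans 0≤x (x≤x+y 0≤y)

  difference : ∀ x y → (y + - x) + x ≈ y
  difference x y = //-rightDividesˡ x y

  difference-nonneg : x ≤ y → 0# ≤ y + - x
  difference-nonneg {x} {y} x≤y = +-cancelʳ-≤ x (begin
    0# + x      ≈⟨ +-identityˡ x ⟩
    x           ≲⟨ x≤y ⟩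
    y           ≈⟨ difference x y ⟨
    y + - x + x ∎)
    where open ≤-Reasoning

  -- A negative product is apart from zero, hence invertible, and then both factors are apart from
  -- zero too. Their signs can thus be told, and every combination is absurd.
  *-nonneg : 0# ≤ x → 0# ≤ y → 0# ≤ x * y
  *-nonneg {x} {y} 0≤x 0≤y xy<0 with #⇒<⊎> x#0 | #⇒<⊎> y#0
    where
    open import Relation.Binary.Reasoning.Setoid (CommutativeRing.setoid commutativeRing)
    xy#0 = <⇒# xy<0
    inverse = proj₁ (#⇒invertible xy#0)
    xy-inverse : inverse * (x * y + - 0#) ≈ 1#
    xy-inverse = proj₁ (proj₂ (#⇒invertible xy#0))
    x-0≈x : ∀ {x} → x + - 0# ≈ x
    x-0≈x {x} = trans (sym (+-identityʳ _)) (difference 0# x)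
    factor# : ∀ {u v} → u * v ≈ x * y → v # 0#
    factor# {u} {v} uv≈xy = invertibleˡ⇒#
      (inverse * u , (begin
        inverse * u * (v + - 0#)   ≈⟨ *-congˡ x-0≈x ⟩
        inverse * u * v            ≈⟨ *-assoc _ _ _ ⟩
        inverse * (u * v)          ≈⟨ *-congˡ (trans uv≈xy (sym x-0≈x)) ⟩
        inverse * (x * y + - 0#)   ≈⟨ xy-inverse ⟩
        1#                         ∎))
    x#0 : x # 0#
    x#0 = factor# (*-comm y x)
    y#0 : y # 0#
    y#0 = factor# refl
  ... | inj₁ x<0 | _        = 0≤x x<0
  ... | _        | inj₁ y<0 = 0≤y y<0
  ... | inj₂ 0<x | inj₂ 0<y = <-asym xy<0 (*-pos 0<x 0<y)

  *-monoʳ-≤ : 0# ≤ z → x ≤ y → z * x ≤ z * y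
  *-monoʳ-≤ {z} {x} {y} 0≤z x≤y = begin
    z * x                      ≲⟨ x≤y+x (*-nonneg 0≤z (difference-nonneg x≤y)) ⟩
    z * (y + - x) + z * x      ≈⟨ distribˡ z _ x ⟨
    z * (y + - x + x)          ≈⟨ *-congˡ (difference x y) ⟩
    z * y                      ∎
    where open ≤-Reasoning

  *-monoˡ-≤ : 0# ≤ z → x ≤ y → x * z ≤ y * z
  *-monoˡ-≤ {z} {x} {y} 0≤z x≤y =
    ≤-trans (≤-reflexive (*-comm x z)) (≤-trans (*-monoʳ-≤ 0≤z x≤y) (≤-reflexive (*-comm z y)))

  -- By contraposition, as squaring is strictly monotone: `√ y * √ y ≤ √ x * √ y < √ x * √ x`.
  √-mono-≤ : 0# ≤ x → x ≤ y → √ x ≤ √ y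
  √-mono-≤ {x} {y} 0≤x x≤y √y<√x =
    x≤y (<-respˡ-≈ (√-square 0≤y) (<-respʳ-≈ (√-square 0≤x) √y²<√x²))
    where
    0≤y = ≤-trans 0≤x x≤y
    0<√x : 0# < √ x
    0<√x = ≤-<-trans (√-nonneg 0≤y) √y<√x
    0<√x-√y : 0# < √ x + - √ y
    0<√x-√y = +-cancelʳ-< (√ y)
      (<-respˡ-≈ (sym (+-identityˡ _)) (<-respʳ-≈ (sym (difference (√ y) (√ x))) √y<√x))
    √y²<√x² : √ y * √ y < √ x * √ x
    √y²<√x² = ≤-<-trans (*-monoˡ-≤ (√-nonneg 0≤y) (<⇒≤ √y<√x)) (<-respˡ-≈ (+-identityˡ _)
      (<-respʳ-≈ (trans (sym (distribˡ _ _ _)) (*-congˡ (difference (√ y) (√ x))))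
        (+-monoˡ-< (√ x * √ y) (*-pos 0<√x 0<√x-√y))))

  -- Totality under double negation suffices wherever the goal is itself a negation, as every `_≤_`
  -- is.
  ≤-total : ¬ ¬ (x ≤ y ⊎ y ≤ x)
  ≤-total k = k (inj₁ (λ y<x → k (inj₂ (<⇒≤ y<x))))

  square-nonneg : ∀ x → 0# ≤ x * x
  square-nonneg x x²<0 = ≤-total
    [ (λ x≤0 → *-nonneg (difference-nonneg x≤0) (difference-nonneg x≤0)
                 (<-respˡ-≈ (neg-square (difference x 0#)) x²<0))
    , (λ 0≤x → *-nonneg 0≤x 0≤x x²<0) ]′
    where
    -- The solver knows semirings only, so `u`, the negative of `x`, enters through `u + x ≈ 0#`.
    neg-square : ∀ {u} → u + x ≈ 0# → x * x ≈ u * u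
    neg-square {u} u+x≈0 = begin
      x * x                   ≈⟨ +-identityˡ _ ⟨
      0# + x * x              ≈⟨ +-congʳ (zeroʳ u) ⟨
      u * 0# + x * x          ≈⟨ +-congʳ (*-congˡ u+x≈0) ⟨
      u * (u + x) + x * x     ≈⟨ solve 2 (λ u x → u :* (u :+ x) :+ x :* x := u :* u :+ x :* (u :+ x)) refl u x ⟩
      u * u + x * (u + x)     ≈⟨ +-congˡ (*-congˡ u+x≈0) ⟩
      u * u + x * 0#          ≈⟨ +-congˡ (zeroʳ x) ⟩
      u * u + 0#              ≈⟨ +-identityʳ _ ⟩
      u * u                   ∎
      where
      open import Relation.Binary.Reasoning.Setoid (CommutativeRing.setoid commutativeRing)
      open Solver

  -- The two sides differ by the square of `d`; putting `d + y` for `x` keeps the identity free of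
  -- subtraction.
  2xy≤x²+y² : ∀ x y → x * y + x * y ≤ x * x + y * y
  2xy≤x²+y² x y = begin
    x * y + x * y                             ≲⟨ x≤y+x (square-nonneg d) ⟩
    d * d + (x * y + x * y)                   ≈⟨ +-congˡ (+-cong (*-congʳ x≈) (*-congʳ x≈)) ⟩
    d * d + ((d + y) * y + (d + y) * y)       ≈⟨ solve 2 (λ d y →
         d :* d :+ ((d :+ y) :* y :+ (d :+ y) :* y) := (d :+ y) :* (d :+ y) :+ y :* y) refl d y ⟩
    (d + y) * (d + y) + y * y                 ≈⟨ +-congʳ (*-cong x≈ x≈) ⟨
    x * x + y * y                             ∎
    where
    open ≤-Reasoning
    open Solver
    d = x + - y
    x≈ : x ≈ d + y
    x≈ = sym (difference y x)

  ·-nonneg : ∀ n → 0# ≤ x → 0# ≤ n · x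
  ·-nonneg zero    0≤x = ≤-refl
  ·-nonneg (suc n) 0≤x = +-nonneg 0≤x (·-nonneg n 0≤x)

  ·-monoʳ-≤ : ∀ n → x ≤ y → n · x ≤ n · y
  ·-monoʳ-≤ zero    x≤y = ≤-refl
  ·-monoʳ-≤ (suc n) x≤y = +-mono-≤ x≤y (·-monoʳ-≤ n x≤y)

  ·-monoˡ-≤ : ∀ {m n} → 0# ≤ x → m ℕ.≤ n → m · x ≤ n · x
  ·-monoˡ-≤ {n = n} 0≤x z≤n = ·-nonneg n 0≤x
  ·-monoˡ-≤ 0≤x (s≤s m≤n)   = +-monoʳ-≤ _ (·-monoˡ-≤ 0≤x m≤n)

  ∑∈-mono : ∀ {n} {S T : Subset n} {f : Vector Carrier n} → (∀ j → 0# ≤ f j) →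
            S ⊆ T → ∑∈ S f ≤ ∑∈ T f
  ∑∈-mono {S = []}          {[]}          0≤f S⊆T = ≤-refl
  ∑∈-mono {S = outside ∷ S} {outside ∷ T} 0≤f S⊆T =
    +-monoʳ-≤ 0# (∑∈-mono (0≤f ∘ suc) (Subset.drop-∷-⊆ S⊆T))
  ∑∈-mono {S = outside ∷ S} {inside ∷ T}  0≤f S⊆T =
    +-mono-≤ (0≤f zero) (∑∈-mono (0≤f ∘ suc) (Subset.drop-∷-⊆ S⊆T))
  ∑∈-mono {S = inside ∷ S}  {outside ∷ T} 0≤f S⊆T with () ← S⊆T Vec.here
  ∑∈-mono {S = inside ∷ S}  {inside ∷ T}  0≤f S⊆T =
    +-monoʳ-≤ _ (∑∈-mono (0≤f ∘ suc) (Subset.drop-∷-⊆ S⊆T))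

  ∑∈-nonneg : ∀ {n} (S : Subset n) {f : Vector Carrier n} → (∀ j → 0# ≤ f j) → 0# ≤ ∑∈ S f
  ∑∈-nonneg []            0≤f = ≤-refl
  ∑∈-nonneg (inside ∷ S)  0≤f = +-nonneg (0≤f zero) (∑∈-nonneg S (0≤f ∘ suc))
  ∑∈-nonneg (outside ∷ S) 0≤f = +-nonneg ≤-refl (∑∈-nonneg S (0≤f ∘ suc))

  ∑∈-linear : ∀ {n} (S : Subset n) (f g : Vector Carrier n) α β →
              ∑∈ S (λ j → α * f j + β * g j) ≈ α * ∑∈ S f + β * ∑∈ S g
  ∑∈-linear []      f g α β = sym (trans (+-cong (zeroʳ α) (zeroʳ β)) (+-identityˡ 0#))
  ∑∈-linear (s ∷ S) f g α β = trans (+-cong (head s) (∑∈-linear S (f ∘ suc) (g ∘ suc) α β))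
    (solve 6 (λ α x X β y Y → (α :* x :+ β :* y) :+ (α :* X :+ β :* Y) := α :* (x :+ X) :+ β :* (y :+ Y))
      refl α _ _ β _ _)
    where
    open Solver
    head : ∀ s → (if s then α * f zero + β * g zero else 0#)
               ≈ α * (if s then f zero else 0#) + β * (if s then g zero else 0#)
    head true  = refl
    head false = sym (trans (+-cong (zeroʳ α) (zeroʳ β)) (+-identityˡ 0#))

  ∑∈-∪ : ∀ {n} (S T : Subset n) {f : Vector Carrier n} → (∀ j → 0# ≤ f j) →
         ∑∈ (S ∪ T) f ≤ ∑∈ S f + ∑∈ T f
  ∑∈-∪ []      []      0≤f = ≤-reflexive (sym (+-identityˡ 0#))
  ∑∈-∪ (s ∷ S) (t ∷ T) {f} 0≤f = ≤-trans (+-mono-≤ (head s t) (∑∈-∪ S T (0≤f ∘ suc)))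
    (≤-reflexive (interchange _ _ _ _))
    where
    head : ∀ s t → (if (s ∨ t) then f zero else 0#)
                 ≤ (if s then f zero else 0#) + (if t then f zero else 0#)
    head true  true  = x≤x+y (0≤f zero)
    head true  false = x≤x+y ≤-refl
    head false t     = ≤-reflexive (sym (+-identityˡ _))

  ∑∈-⊥ : ∀ n (f : Vector Carrier n) → ∑∈ (⊥ {n}) f ≈ 0#
  ∑∈-⊥ zero    f = refl
  ∑∈-⊥ (suc n) f = trans (+-identityˡ _) (∑∈-⊥ n (f ∘ suc))

  ∑∈-⁅⁆ : ∀ {n} (j : Fin n) (f : Vector Carrier n) → ∑∈ ⁅ j ⁆ f ≈ f j
  ∑∈-⁅⁆ {suc n} zero    f = trans (+-congˡ (∑∈-⊥ n (f ∘ suc))) (+-identityʳ _)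
  ∑∈-⁅⁆ {suc n} (suc j) f = trans (+-identityˡ _) (∑∈-⁅⁆ j (f ∘ suc))

  -- In effect `x - y ≤ f j` summed over `S`, with `y` moved across to avoid subtraction.
  ∑∈-lower : ∀ {n} (S : Subset n) (f : Vector Carrier n) → (∀ j → j ∈ₛ S → x ≤ y + f j) →
             ∣ S ∣ · x ≤ ∣ S ∣ · y + ∑∈ S f
  ∑∈-lower []            f x≤ = ≤-reflexive (sym (+-identityˡ 0#))
  ∑∈-lower (inside ∷ S)  f x≤ = ≤-trans
    (+-mono-≤ (x≤ zero Vec.here) (∑∈-lower S (f ∘ suc) (λ j → x≤ (suc j) ∘ Vec.there)))
    (≤-reflexive (interchange _ _ _ _))
  ∑∈-lower (outside ∷ S) f x≤ = ≤-trans
    (∑∈-lower S (f ∘ suc) (λ j → x≤ (suc j) ∘ Vec.there))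
    (+-monoʳ-≤ _ (≤-reflexive (sym (+-identityˡ _))))

-- Linearised weights of feasible and infeasible sets.

module Weights {c ℓ₁ ℓ₂ ℓ₃} {F : EuclideanField c ℓ₁ ℓ₂ ℓ₃} {N : ℕ} (I : SMBP F N) where
  open EuclideanFieldProperties F
  open SMBP I

  Θ : Carrier
  Θ = V * V

  0<Θ : 0# < Θ
  0<Θ = *-pos V-pos V-pos

  -- With z = D √b(S), feasibility of S reads μ(S) + z ≤ V, and V μ(S) + z² is
  -- linear in the jobs.  It is at most V² if S is feasible, and at least
  -- V² - V z + z² ≥ ¾ V² if not.  The factor 8 clears denominators.
  weight : Vector Carrier N
  weight j = 8 · V * μ j + 8 · (D * D) * b j

  ω : Subset N → Carrier
  ω S = ∑∈ S weight

  weight-nonneg : ∀ j → 0# ≤ weight j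
  weight-nonneg j = +-nonneg
    (*-nonneg (·-nonneg 8 (<⇒≤ V-pos)) (μ-nonneg j))
    (*-nonneg (·-nonneg 8 (*-nonneg D-nonneg D-nonneg)) (b-nonneg j))

  Feasible-antitone : ∀ {S T} → S ⊆ T → Feasible T → Feasible S
  Feasible-antitone {S} S⊆T = ≤-trans (+-mono-≤ (∑∈-mono μ-nonneg S⊆T)
    (*-monoʳ-≤ D-nonneg (√-mono-≤ (∑∈-nonneg S b-nonneg) (∑∈-mono b-nonneg S⊆T))))

  module _ (S : Subset N) where
    private
      m z : Carrier
      m = ∑∈ S μ
      z = D * √ (∑∈ S b)

      0≤m : 0# ≤ m
      0≤m = ∑∈-nonneg S μ-nonneg

      0≤z : 0# ≤ z
      0≤z = *-nonneg D-nonneg (√-nonneg (∑∈-nonneg S b-nonneg))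

      open Solver

      ω-via-z : ω S ≈ 8 · (V * m + z * z)
      ω-via-z = begin
        ω S                                      ≈⟨ ∑∈-linear S μ b (8 · V) (8 · (D * D)) ⟩
        8 · V * m + 8 · (D * D) * ∑∈ S b         ≈⟨ +-congˡ (*-congˡ (√-square (∑∈-nonneg S b-nonneg))) ⟨
        8 · V * m + 8 · (D * D) * (√B * √B)      ≈⟨ solve 4 (λ V m D r →
            8 :· V :* m :+ 8 :· (D :* D) :* (r :* r) := 8 :· (V :* m :+ (D :* r) :* (D :* r)))
            refl V m D √B ⟩
        8 · (V * m + z * z)                      ∎
        where
        open import Relation.Binary.Reasoning.Setoid (CommutativeRing.setoid commutativeRing)
        √B = √ (∑∈ S b)

    -- From `m + z ≤ V` follows `z ≤ V`, hence `z * z ≤ V * z`.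
    feasible⇒ω≤ : Feasible S → ω S ≤ 8 · Θ
    feasible⇒ω≤ m+z≤V = begin
      ω S                  ≈⟨ ω-via-z ⟩
      8 · (V * m + z * z)  ≲⟨ ·-monoʳ-≤ 8 (+-monoʳ-≤ _ (*-monoˡ-≤ 0≤z (≤-trans (x≤y+x 0≤m) m+z≤V))) ⟩
      8 · (V * m + V * z)  ≈⟨ ×-congʳ 8 (distribˡ V m z) ⟨
      8 · (V * (m + z))    ≲⟨ ·-monoʳ-≤ 8 (*-monoʳ-≤ (<⇒≤ V-pos) m+z≤V) ⟩
      8 · Θ                ∎
      where open ≤-Reasoning

    -- The inequality `2xy≤x²+y²` for `V` and `2 · z` gives `4 V z ≤ V² + 4 z²`, whence
    -- `V² - V z + z² ≥ ¾ V²`.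
    infeasible⇒≤ω : ¬ Feasible S → 6 · Θ ≤ ω S
    -- `Feasible` is a negation, so `infeasible` asserts `V < m + z` doubly negated; it can be used
    -- because the goal is a negation. Adding `8 · (V * z)` to both sides avoids subtraction.
    infeasible⇒≤ω infeasible ω<6Θ = infeasible λ V<m+z → +-cancelʳ-≤ (8 · (V * z)) (begin
      6 · Θ + 8 · (V * z)                   ≈⟨ solve 2 (λ V z → 6 :· (V :* V) :+ 8 :· (V :* z) :=
           6 :· (V :* V) :+ 2 :· (V :* (2 :· z) :+ V :* (2 :· z))) refl V z ⟩
      6 · Θ + 2 · (V * (2 · z) + V * (2 · z)) ≲⟨ +-monoʳ-≤ _ (·-monoʳ-≤ 2 (2xy≤x²+y² V (2 · z))) ⟩
      6 · Θ + 2 · (V * V + 2 · z * (2 · z)) ≈⟨ solve 2 (λ V z →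
           6 :· (V :* V) :+ 2 :· (V :* V :+ 2 :· z :* (2 :· z)) := 8 :· (V :* V) :+ 8 :· (z :* z)) refl V z ⟩
      8 · Θ + 8 · (z * z)                   ≲⟨ +-monoˡ-≤ _ (·-monoʳ-≤ 8 (*-monoʳ-≤ (<⇒≤ V-pos) (<⇒≤ V<m+z))) ⟩
      8 · (V * (m + z)) + 8 · (z * z)       ≈⟨ solve 3 (λ V m z →
           8 :· (V :* (m :+ z)) :+ 8 :· (z :* z) := 8 :· (V :* m :+ z :* z) :+ 8 :· (V :* z)) refl V m z ⟩
      8 · (V * m + z * z) + 8 · (V * z)     ≈⟨ +-congʳ ω-via-z ⟨
      ω S + 8 · (V * z)                     ∎) ω<6Θ
      where open ≤-Reasoning

-- Lists and finite sums of natural numbers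

open import Data.Nat using (_+_; _*_; _^_; _≤_; _<_)
open ≡ using (refl; sym; trans; cong; subst)

private variable
  a ℓ : Level
  A : Set a

-- The pigeonhole principle, through which most counts of machines and jobs are compared. The
-- induction deletes one occurrence of `x` from `ys`.
unique-⊆⇒length≤ : {xs ys : List A} → Unique xs → (∀ {x} → x ∈ xs → x ∈ ys) → length xs ≤ length ys
unique-⊆⇒length≤ []             xs⊆ys = z≤n
unique-⊆⇒length≤ {xs = x ∷ xs} (x∉xs ∷ xs!) xs⊆ys with ∈-∃++ (xs⊆ys (here refl))
... | as , bs , refl = begin
  suc (length xs)                ≤⟨ s≤s (unique-⊆⇒length≤ xs! λ y∈xs →
                                      delete (All.lookup x∉xs y∈xs) (xs⊆ys (there y∈xs))) ⟩
  suc (length (as ++ bs))        ≡⟨ cong suc (length-++ as) ⟩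
  suc (length as + length bs)    ≡⟨ ℕ.+-suc (length as) (length bs) ⟨
  length as + suc (length bs)    ≡⟨ length-++ as ⟨
  length (as ++ x ∷ bs)          ∎
  where
  open ℕ.≤-Reasoning
  delete : ∀ {y} → x ≢ y → y ∈ as ++ x ∷ bs → y ∈ as ++ bs
  delete x≢y y∈ with ∈-++⁻ as y∈
  ... | inj₁ y∈as         = ∈-++⁺ˡ y∈as
  ... | inj₂ (here y≡x)   = contradiction (sym y≡x) x≢y
  ... | inj₂ (there y∈bs) = ∈-++⁺ʳ as y∈bs

lookup-injective : {xs : List A} → Unique xs → ∀ {i j} → List.lookup xs i ≡ List.lookup xs j → i ≡ j
lookup-injective (x∉xs ∷ xs!) {zero}  {zero}  _  = refl
lookup-injective {xs = _ ∷ xs} (x∉xs ∷ xs!) {zero} {suc j} eq =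
  contradiction eq (All.lookup x∉xs (∈-lookup j))
lookup-injective {xs = _ ∷ xs} (x∉xs ∷ xs!) {suc i} {zero} eq =
  contradiction (sym eq) (All.lookup x∉xs (∈-lookup i))
lookup-injective (x∉xs ∷ xs!) {suc i} {suc j} eq = cong suc (lookup-injective xs! eq)

length-filter-tabulate : ∀ {n} {P : Pred A ℓ} (P? : Decidable P) (f : Fin n → A) →
                         length (filter P? (tabulate f)) ≡ ∣ Vec.tabulate (does ∘ P? ∘ f) ∣
length-filter-tabulate {n = zero}  P? f = refl
length-filter-tabulate {n = suc n} P? f with does (P? (f zero))
... | true  = cong suc (length-filter-tabulate P? (f ∘ suc))
... | false = length-filter-tabulate P? (f ∘ suc)

∣∣>0⇒Nonempty : ∀ {n} (S : Subset n) → 1 ≤ ∣ S ∣ → Nonempty S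
∣∣>0⇒Nonempty {n} S 1≤∣S∣ with Subset.nonempty? S
... | yes nonempty = nonempty
... | no  empty    rewrite Subset.Empty-unique empty | Subset.∣⊥∣≡0 n with () ← 1≤∣S∣

∑ : ∀ {n} → Vector ℕ n → ℕ
∑ f = sum (tabulate f)

∑-mono : ∀ {n} {f g : Vector ℕ n} → (∀ j → f j ≤ g j) → ∑ f ≤ ∑ g
∑-mono {zero}  f≤g = z≤n
∑-mono {suc n} f≤g = ℕ.+-mono-≤ (f≤g zero) (∑-mono (f≤g ∘ suc))

∑-mono-< : ∀ {n} {f g : Vector ℕ n} → (∀ j → f j ≤ g j) → ∀ k → f k < g k → ∑ f < ∑ g
∑-mono-< f≤g zero    fk<gk = ℕ.+-mono-<-≤ fk<gk (∑-mono (f≤g ∘ suc))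
∑-mono-< f≤g (suc k) fk<gk = ℕ.+-mono-≤-< (f≤g zero) (∑-mono-< (f≤g ∘ suc) k fk<gk)

∑-bound : ∀ {n} {f : Vector ℕ n} c → (∀ j → f j ≤ c) → ∑ f ≤ n * c
∑-bound {zero}  c f≤c = z≤n
∑-bound {suc n} c f≤c = ℕ.+-mono-≤ (f≤c zero) (∑-bound c (f≤c ∘ suc))

-- Termination and preservation of feasibility

module LocalSearchProperties {c ℓ₁ ℓ₂ ℓ₃} {F : EuclideanField c ℓ₁ ℓ₂ ℓ₃} {N : ℕ} (I : SMBP F N) where
  open LocalSearch I
  open SMBP I using (Feasible)
  open Weights I using (Feasible-antitone)

  machines : Assignment → List ℕ
  machines σ = deduplicate ℕ._≟_ (tabulate σ)

  machines-unique : ∀ σ → Unique (machines σ)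
  machines-unique σ = deduplicate-! (tabulate σ)

  ∈-machines⁺ : ∀ {σ i} → Purchased σ i → i ∈ machines σ
  ∈-machines⁺ {σ} (j , refl) = ∈-deduplicate⁺ ℕ._≟_ (∈-tabulate⁺ {f = σ} j)

  ∈-machines⁻ : ∀ {σ i} → i ∈ machines σ → Purchased σ i
  ∈-machines⁻ {σ} i∈ with j , i≡ ← ∈-tabulate⁻ {f = σ} (∈-deduplicate⁻ ℕ._≟_ (tabulate σ) i∈) = j , sym i≡

  #machines≤N : ∀ σ → #machines σ ≤ N
  #machines≤N σ = ℕ.≤-trans (length-deduplicate ℕ._≟_ (tabulate σ)) (ℕ.≤-reflexive (length-tabulate σ))

  ∈-jobs⁺ : ∀ σ {i j} → σ j ≡ i → j ∈ₛ jobs σ i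
  ∈-jobs⁺ σ {i} {j} eq = Vec.lookup⇒[]= j (jobs σ i)
    (trans (Vec.lookup∘tabulate _ j) (dec-true (σ j ℕ.≟ i) eq))

  ∈-jobs⁻ : ∀ σ {i j} → j ∈ₛ jobs σ i → σ j ≡ i
  ∈-jobs⁻ σ {i} {j} j∈ = ℕ.≡ᵇ⇒≡ (σ j) i
    (subst T (sym (trans (sym (Vec.lookup∘tabulate _ j)) (Vec.[]=⇒lookup j∈))) _)

  nonempty⇒Purchased : ∀ σ {i} → 1 ≤ ∣ jobs σ i ∣ → Purchased σ i
  nonempty⇒Purchased σ {i} 1≤ with j , j∈ ← ∣∣>0⇒Nonempty (jobs σ i) 1≤ = j , ∈-jobs⁻ σ j∈

  A₁⇒Purchased : ∀ {σ i} → A₁ σ i → Purchased σ i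
  A₁⇒Purchased {σ} one = nonempty⇒Purchased σ (ℕ.≤-reflexive (sym one))

  Medium⇒¬A₁ : ∀ σ {i} → Medium σ i → ¬ A₁ σ i
  Medium⇒¬A₁ σ (2≤ , _) one = ℕ.<-irrefl refl (ℕ.≤-trans 2≤ (ℕ.≤-reflexive one))

  -- The position of `i` among the purchased identifiers, counted from 1. Identifiers are unbounded,
  -- whereas the rank of a purchased machine is at most `N`.
  rank : Assignment → ℕ → ℕ
  rank σ i = length (i ∷ filter (ℕ._<? i) (machines σ))

  ranks : Assignment → ℕ
  ranks σ = ∑ (rank σ ∘ σ)

  rank≤#machines : ∀ σ {i} → Purchased σ i → rank σ i ≤ #machines σ
  rank≤#machines σ {i} bought = unique-⊆⇒length≤
    (¬Any⇒All¬ _ (ℕ.<-irrefl refl ∘ proj₂ ∘ ∈-filter⁻ (ℕ._<? i) {xs = machines σ})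
      ∷ Unique.filter⁺ (ℕ._<? i) (machines-unique σ))
    λ where
      (here refl) → ∈-machines⁺ bought
      (there i′∈) → proj₁ (∈-filter⁻ (ℕ._<? i) {xs = machines σ} i′∈)

  ranks≤N² : ∀ σ → ranks σ ≤ N * N
  ranks≤N² σ = ∑-bound N λ j → ℕ.≤-trans (rank≤#machines σ (j , refl)) (#machines≤N σ)

  -- Encodes the lexicographic order on the number of machines and the sum of ranks, the latter
  -- being at most `N * N`.
  potential : Assignment → ℕ
  potential σ = #machines σ * (N * N) + ranks σ

  ranks>0 : ∀ σ → Fin N → 0 < ranks σ
  ranks>0 σ j = ℕ.≤-<-trans z≤n (∑-mono-< {f = const 0} {rank σ ∘ σ} (λ _ → z≤n) j (s≤s z≤n))

  -- One machine less pays for any sum of ranks in `τ`; strictness comes from `ranks σ` being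
  -- positive, which takes a job.
  drop-machine : ∀ {σ τ} → Fin N → #machines τ < #machines σ → potential τ < potential σ
  drop-machine {σ} {τ} j fewer = begin-strict
    #machines τ * (N * N) + ranks τ   ≤⟨ ℕ.+-monoʳ-≤ (#machines τ * (N * N)) (ranks≤N² τ) ⟩
    #machines τ * (N * N) + N * N     ≡⟨ ℕ.+-comm _ (N * N) ⟩
    suc (#machines τ) * (N * N)       ≤⟨ ℕ.*-monoˡ-≤ (N * N) fewer ⟩
    #machines σ * (N * N)             <⟨ ℕ.m<m+n _ (ranks>0 σ j) ⟩
    #machines σ * (N * N) + ranks σ   ∎
    where open ℕ.≤-Reasoning

  -- Covers operations (2) and (3): `i` and the machines of `τ` together embed into those of `σ`,
  -- because hosts are purchased machines of A₁ and `i`, being medium, is no host.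
  Spread-release : ∀ {σ τ i} → Medium σ i → Spread σ τ (λ k → σ k ≡ i) →
                   Unchanged σ τ (λ k → σ k ≢ i) → #machines τ < #machines σ
  Spread-release {σ} {τ} {i} medium (spread , _) unchanged = unique-⊆⇒length≤
    (¬Any⇒All¬ _ (released ∘ ∈-machines⁻) ∷ machines-unique τ)
    λ where
      (here refl) → ∈-machines⁺ (nonempty⇒Purchased σ (ℕ.≤-trans (s≤s z≤n) (proj₁ medium)))
      (there i′∈) → ∈-machines⁺ (uncurry old (∈-machines⁻ i′∈))
    where
    released : ¬ Purchased τ i
    released (k , τk≡i) with σ k ℕ.≟ i
    ... | yes σk≡i = Medium⇒¬A₁ σ medium (subst (A₁ σ) τk≡i (proj₁ (spread k σk≡i)))
    ... | no  σk≢i = σk≢i (trans (sym (unchanged k σk≢i)) τk≡i)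
    old : ∀ {i′} k → τ k ≡ i′ → Purchased σ i′
    old k refl with σ k ℕ.≟ i
    ... | yes σk≡i = A₁⇒Purchased (proj₁ (spread k σk≡i))
    ... | no  σk≢i = k , sym (unchanged k σk≢i)

  data Origin₄ (σ τ : Assignment) i₁ i₂ j₁ j₂ new k : Set where
    joined    : k ≡ j₁ ⊎ k ≡ j₂ → τ k ≡ new → Origin₄ σ τ i₁ i₂ j₁ j₂ new k
    scattered : (σ k ≡ i₁ ⊎ σ k ≡ i₂) × k ≢ j₁ × k ≢ j₂ → Origin₄ σ τ i₁ i₂ j₁ j₂ new k
    kept      : σ k ≢ i₁ → σ k ≢ i₂ → Origin₄ σ τ i₁ i₂ j₁ j₂ new k

  origin₄ : ∀ {σ τ i₁ i₂ j₁ j₂ new} → τ j₁ ≡ new → τ j₂ ≡ new → ∀ k → Origin₄ σ τ i₁ i₂ j₁ j₂ new k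
  origin₄ {σ} {i₁ = i₁} {i₂} {j₁} {j₂} τj₁ τj₂ k with k Fin.≟ j₁ | k Fin.≟ j₂ | (σ k ℕ.≟ i₁) ⊎-dec (σ k ℕ.≟ i₂)
  ... | yes refl | _        | _        = joined (inj₁ refl) τj₁
  ... | no _     | yes refl | _        = joined (inj₂ refl) τj₂
  ... | no k≢j₁  | no k≢j₂  | yes i₁⊎i₂ = scattered (i₁⊎i₂ , k≢j₁ , k≢j₂)
  ... | no _     | no _     | no ¬i₁⊎i₂ = kept (¬i₁⊎i₂ ∘ inj₁) (¬i₁⊎i₂ ∘ inj₂)

  potential-decreases : ∀ {σ τ} → Step σ τ → potential τ < potential σ
  potential-decreases {σ} {τ} (op₁ j i bought i<σj _ τj≡i others) =
    ℕ.+-mono-≤-< (ℕ.*-monoˡ-≤ (N * N) (unique-⊆⇒length≤ (machines-unique τ) ⊆-machines))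
      (∑-mono-< rank≤ j rank<)
    where
    ⊆-machines : ∀ {i′} → i′ ∈ machines τ → i′ ∈ machines σ
    ⊆-machines i′∈ with k , refl ← ∈-machines⁻ {τ} i′∈ | k Fin.≟ j
    ... | yes refl = ∈-machines⁺ (subst (Purchased σ) (sym τj≡i) bought)
    ... | no  k≢j  = ∈-machines⁺ (k , sym (others k k≢j))
    filter-⊆ : ∀ i′ {i″} → i″ ∈ filter (ℕ._<? i′) (machines τ) → i″ ∈ filter (ℕ._<? i′) (machines σ)
    filter-⊆ i′ i″∈ with i″∈τ , i″<i′ ← ∈-filter⁻ (ℕ._<? i′) {xs = machines τ} i″∈ =
      ∈-filter⁺ (ℕ._<? i′) (⊆-machines i″∈τ) i″<i′
    rank-mono : ∀ i′ → rank τ i′ ≤ rank σ i′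
    rank-mono i′ = s≤s (unique-⊆⇒length≤ (Unique.filter⁺ (ℕ._<? i′) (machines-unique τ)) (filter-⊆ i′))
    -- The machines of `τ` below `i`, and `i` in addition, all lie below `σ j` in `σ`.
    rank< : rank τ (τ j) < rank σ (σ j)
    rank< rewrite τj≡i = s≤s (unique-⊆⇒length≤
      (¬Any⇒All¬ _ (ℕ.<-irrefl refl ∘ proj₂ ∘ ∈-filter⁻ (ℕ._<? i) {xs = machines τ})
        ∷ Unique.filter⁺ (ℕ._<? i) (machines-unique τ))
      λ where
        (here refl) → ∈-filter⁺ (ℕ._<? σ j) (∈-machines⁺ bought) i<σj
        (there i′∈) → let i′∈σ , i′<i = ∈-filter⁻ (ℕ._<? i) {xs = machines σ} (filter-⊆ i i′∈)
                      in ∈-filter⁺ (ℕ._<? σ j) i′∈σ (ℕ.<-trans i′<i i<σj))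
    rank≤ : ∀ k → rank τ (τ k) ≤ rank σ (σ k)
    rank≤ k with k Fin.≟ j
    ... | yes refl = ℕ.<⇒≤ rank<
    ... | no  k≢j rewrite others k k≢j = rank-mono (σ k)
  potential-decreases {σ} {τ} (op₂ i medium _ spreads others) =
    drop-machine (proj₁ (nonempty⇒Purchased σ {i} (ℕ.≤-trans (s≤s z≤n) (proj₁ medium))))
      (Spread-release medium spreads others)
  potential-decreases (op₃ i j medium _ _ _ spreads others) =
    drop-machine j (Spread-release medium spreads others)
  potential-decreases {σ} {τ} (op₄ i₁ i₂ j₁ j₂ new i₁≢i₂ (medium₁ , σj₁ , _) (medium₂ , σj₂ , _) _
                         unused τj₁ τj₂ (spreads , _) others) =
    -- Two machines are released and one is bought, so `i₁`, `i₂` and the machines of `τ` embed into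
    -- `new` and the machines of `σ`.
    drop-machine j₁ (ℕ.s≤s⁻¹ (unique-⊆⇒length≤ {xs = i₁ ∷ i₂ ∷ machines τ} {ys = new ∷ machines σ}
      ((i₁≢i₂ ∷ ¬Any⇒All¬ _ (released (inj₁ refl) ∘ ∈-machines⁻))
        ∷ ¬Any⇒All¬ _ (released (inj₂ refl) ∘ ∈-machines⁻) ∷ machines-unique τ)
      λ where
        (here refl)         → there (∈-machines⁺ (j₁ , σj₁))
        (there (here refl)) → there (∈-machines⁺ (j₂ , σj₂))
        (there (there i∈))  → uncurry old (∈-machines⁻ {τ} i∈)))
    where
    medium : ∀ {i} → i ≡ i₁ ⊎ i ≡ i₂ → Medium σ i
    medium (inj₁ refl) = medium₁
    medium (inj₂ refl) = medium₂
    released : ∀ {i} → i ≡ i₁ ⊎ i ≡ i₂ → ¬ Purchased τ i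
    released i∈ (k , τk) with origin₄ {σ} {τ} {i₁} {i₂} τj₁ τj₂ k
    ... | joined _ τk≡new = unused (subst (Purchased σ) (trans (sym τk) τk≡new)
            (nonempty⇒Purchased σ (ℕ.≤-trans (s≤s z≤n) (proj₁ (medium i∈)))))
    ... | scattered Pk = Medium⇒¬A₁ σ (medium i∈) (subst (A₁ σ) τk (proj₁ (spreads k Pk)))
    ... | kept ≢i₁ ≢i₂ with i∈
    ...   | inj₁ i≡ = ≢i₁ (trans (sym (others k (≢i₁ , ≢i₂))) (trans τk i≡))
    ...   | inj₂ i≡ = ≢i₂ (trans (sym (others k (≢i₁ , ≢i₂))) (trans τk i≡))
    old : ∀ {i} k → τ k ≡ i → i ∈ new ∷ machines σ
    old k refl with origin₄ {σ} {τ} {i₁} {i₂} τj₁ τj₂ k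
    ... | joined _ τk≡new       = here τk≡new
    ... | scattered Pk             = there (∈-machines⁺ (A₁⇒Purchased (proj₁ (spreads k Pk))))
    ... | kept ≢i₁ ≢i₂     = there (∈-machines⁺ (k , sym (others k (≢i₁ , ≢i₂))))

  Run-potential : ∀ {n σ τ} → Run n σ τ → n + potential τ ≤ potential σ
  Run-potential []         = ℕ.≤-refl
  Run-potential (step ∷ r) = ℕ.≤-trans (s≤s (Run-potential r)) (potential-decreases step)

  -- The potential starts at no more than `N ^ 3 + N * N`; this lower bound on its final value
  -- brings the number of operations down to `N ^ 3`.
  N²≤potential : ∀ σ → N * N ≤ potential σ
  N²≤potential σ = ℕ.≤-trans (N≤ N refl) (ℕ.m≤m+n _ _)
    where
    N≤ : ∀ n → N ≡ n → N * N ≤ #machines σ * (N * N)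
    N≤ zero    refl = z≤n
    N≤ (suc n) refl = ℕ.≤-trans (ℕ.≤-reflexive (sym (ℕ.*-identityˡ _)))
      (ℕ.*-monoˡ-≤ (N * N) (∈-length (∈-machines⁺ {σ} (zero , refl))))

  Run-length : ∀ {n σ τ} → Run n σ τ → n ≤ N ^ 3
  Run-length {n} {σ} {τ} r = ℕ.+-cancelʳ-≤ (N * N) n (N ^ 3) (begin
    n + N * N                          ≤⟨ ℕ.+-monoʳ-≤ n (N²≤potential τ) ⟩
    n + potential τ                    ≤⟨ Run-potential r ⟩
    #machines σ * (N * N) + ranks σ    ≤⟨ ℕ.+-mono-≤ (ℕ.*-monoˡ-≤ (N * N) (#machines≤N σ)) (ranks≤N² σ) ⟩
    N * (N * N) + N * N                ≡⟨ cong (λ m → N * (N * m) + N * N) (ℕ.*-identityʳ N) ⟨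
    N ^ 3 + N * N                      ∎)
    where open ℕ.≤-Reasoning

  -- `P` marks the relocated jobs. At most one of them enters machine `i`, where it fits, and all
  -- else on `i` was there before.
  relocate-feasible : ∀ {σ τ i} {P : Fin N → Set ℓ} → (∀ k → Dec (P k)) → FeasibleAssignment σ →
    (∀ k → P k → τ k ≡ i → Fits σ k i) →
    (∀ k l → P k → P l → τ k ≡ i → τ l ≡ i → k ≡ l) →
    (∀ k → ¬ P k → τ k ≡ i → σ k ≡ i) →
    Purchased τ i → Feasible (jobs τ i)
  relocate-feasible {σ = σ} {τ} {i} P? feasible fits unique unchanged (k₀ , τk₀)
    with any? (λ k → P? k ×-dec (τ k ℕ.≟ i))
  ... | yes (k , Pk , τk) = Feasible-antitone contained (fits k Pk τk)
    where
    contained : jobs τ i ⊆ jobs σ i ∪ ⁅ k ⁆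
    contained {l} l∈ with P? l
    ... | yes Pl rewrite unique l k Pl Pk (∈-jobs⁻ τ l∈) τk = Subset.x∈p∪q⁺ (inj₂ (Subset.x∈⁅x⁆ k))
    ... | no ¬Pl = Subset.x∈p∪q⁺ (inj₁ (∈-jobs⁺ σ (unchanged l ¬Pl (∈-jobs⁻ τ l∈))))
  ... | no none = Feasible-antitone
    (λ {l} l∈ → ∈-jobs⁺ σ (stays l (∈-jobs⁻ τ l∈))) (feasible i (k₀ , stays k₀ τk₀))
    where
    stays : ∀ k → τ k ≡ i → σ k ≡ i
    stays k τk = unchanged k (λ Pk → none (k , Pk , τk)) τk

  Step-feasible : ∀ {σ τ} → Step σ τ → FeasibleAssignment σ → FeasibleAssignment τ
  Step-feasible {σ} (op₁ j i _ _ fits refl others) feasible i′ =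
    relocate-feasible (Fin._≟ j) feasible
      (λ { k refl refl → fits })
      (λ { k l refl refl _ _ → refl })
      (λ k k≢j τk → trans (sym (others k k≢j)) τk)
  Step-feasible {σ} (op₂ i _ _ (spreads , distinct) others) feasible i′ =
    relocate-feasible (λ k → σ k ℕ.≟ i) feasible
      (λ { k σk refl → proj₂ (spreads k σk) })
      (λ k l σk σl τk τl → distinct k l σk σl (trans τk (sym τl)))
      (λ k σk τk → trans (sym (others k σk)) τk)
  Step-feasible {σ} (op₃ i j _ _ _ _ (spreads , distinct) others) feasible i′ =
    relocate-feasible (λ k → σ k ℕ.≟ i) feasible
      (λ { k σk refl → proj₂ (spreads k σk) })
      (λ k l σk σl τk τl → distinct k l σk σl (trans τk (sym τl)))
      (λ k σk τk → trans (sym (others k σk)) τk)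
  Step-feasible {σ} {τ} (op₄ i₁ i₂ j₁ j₂ new _ _ _ pair-feasible unused τj₁ τj₂ (spreads , distinct) others)
                feasible i′ bought with i′ ℕ.≟ new
  -- Only `j₁` and `j₂` can be on `new`: all other jobs sit on machines purchased in `σ`.
  ... | yes refl = Feasible-antitone contained pair-feasible
    where
    contained : jobs τ new ⊆ ⁅ j₁ ⁆ ∪ ⁅ j₂ ⁆
    contained {k} k∈ with refl ← ∈-jobs⁻ τ k∈ | origin₄ {σ} {τ} {i₁} {i₂} τj₁ τj₂ k
    ... | joined (inj₁ refl) _  = Subset.x∈p∪q⁺ (inj₁ (Subset.x∈⁅x⁆ k))
    ... | joined (inj₂ refl) _  = Subset.x∈p∪q⁺ (inj₂ (Subset.x∈⁅x⁆ k))
    ... | scattered Pk             = contradiction (A₁⇒Purchased (proj₁ (spreads k Pk))) unused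
    ... | kept ≢i₁ ≢i₂     = contradiction (k , sym (others k (≢i₁ , ≢i₂))) unused
  ... | no i′≢new = relocate-feasible
      (λ k → ((σ k ℕ.≟ i₁) ⊎-dec (σ k ℕ.≟ i₂)) ×-dec ¬? (k Fin.≟ j₁) ×-dec ¬? (k Fin.≟ j₂)) feasible
      (λ { k Pk refl → proj₂ (spreads k Pk) })
      (λ k l Pk Pl τk τl → distinct k l Pk Pl (trans τk (sym τl)))
      stays bought
    where
    stays : ∀ k → ¬ _ → τ k ≡ i′ → σ k ≡ i′
    stays k ¬Pk refl with origin₄ {σ} {τ} {i₁} {i₂} τj₁ τj₂ k
    ... | joined _ τk≡new   = contradiction τk≡new i′≢new
    ... | scattered Pk         = contradiction Pk ¬Pk
    ... | kept ≢i₁ ≢i₂ = sym (others k (≢i₁ , ≢i₂))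

  Run-feasible : ∀ {n σ τ} → Run n σ τ → FeasibleAssignment σ → FeasibleAssignment τ
  Run-feasible []         feasible = feasible
  Run-feasible (step ∷ r) feasible = Run-feasible r (Step-feasible step feasible)

-- Terminal assignments

module TerminalProperties {c ℓ₁ ℓ₂ ℓ₃} {F : EuclideanField c ℓ₁ ℓ₂ ℓ₃} {N : ℕ} (I : SMBP F N) where
  open LocalSearch I
  open SMBP I using (Feasible)
  open LocalSearchProperties I

  avoid : (f : Fin 6 ↣ ℕ) (U : List ℕ) → length U < 6 → ∃[ k ] Injection.to f k ∉ U
  avoid f U U<6 with any? (λ k → ¬? (Injection.to f k ∈? U))
  ... | yes found = found
  ... | no  none  = contradiction
    (unique-⊆⇒length≤ (Unique.tabulate⁺ (Injection.injective f)) ⊆U) (ℕ.<⇒≱ U<6)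
    where
    ⊆U : ∀ {i} → i ∈ tabulate (Injection.to f) → i ∈ U
    ⊆U i∈ with k , refl ← ∈-tabulate⁻ {f = Injection.to f} i∈ =
      decidable-stable (_ ∈? U) λ ∉U → none (k , ∉U)

  -- `U` collects the identifiers already taken, and `τ₀` places the jobs outside `js`. Fitting
  -- refers to `σ` throughout, as it does in the operations.
  record Scattering (σ τ₀ : Assignment) (U : List ℕ) (js : List (Fin N)) : Set ℓ₃ where
    field
      τ        : Assignment
      host     : ∀ j → j ∈ js → A₁ σ (τ j) × Fits σ j (τ j)
      avoids   : ∀ j → j ∈ js → τ j ∉ U
      distinct : ∀ j k → j ∈ js → k ∈ js → τ j ≡ τ k → j ≡ k
      others   : ∀ j → j ∉ js → τ j ≡ τ₀ j

  -- Greedily: each job has six hosts, of which fewer than six are taken.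
  scatter : ∀ σ τ₀ U js → Unique js → length U + length js ≤ 6 → (∀ j → j ∈ js → Good σ j) →
            Scattering σ τ₀ U js
  scatter σ τ₀ U [] _ _ _ = record
    { τ = τ₀ ; host = λ _ () ; avoids = λ _ () ; distinct = λ _ _ () ; others = λ _ _ → refl }
  scatter σ τ₀ U (j ∷ js) (j∉js ∷ js!) ≤6 good = record
    { τ        = τ
    ; host     = λ { k (here refl) → subst (λ i → A₁ σ i × Fits σ j i) (sym τj) (hosts h)
                   ; k (there k∈)  → host k k∈ }
    ; avoids   = λ { k (here refl) → subst (_∉ U) (sym τj) ∉U
                   ; k (there k∈)  → avoids k k∈ ∘ there }
    ; distinct = λ { k l (here refl) (here refl) _  → refl
                   ; k l (here refl) (there l∈) eq → contradiction (here (trans (sym eq) τj)) (avoids l l∈)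
                   ; k l (there k∈) (here refl) eq → contradiction (here (trans eq τj)) (avoids k k∈)
                   ; k l (there k∈) (there l∈)  eq → distinct k l k∈ l∈ eq }
    ; others   = λ k k∉ → trans (others k (k∉ ∘ there)) (updateAt-minimal k j τ₀ (k∉ ∘ here))
    }
    where
    f = proj₁ (proj₂ (good j (here refl)))
    hosts = proj₂ (proj₂ (good j (here refl)))
    suc≤6 : suc (length U) + length js ≤ 6
    suc≤6 = ℕ.≤-trans (ℕ.≤-reflexive (sym (ℕ.+-suc (length U) (length js)))) ≤6
    found = avoid f U (ℕ.≤-trans (ℕ.m≤m+n _ (length js)) suc≤6)
    h = proj₁ found
    ∉U = proj₂ found
    open Scattering (scatter σ (updateAt τ₀ j (const (Injection.to f h))) (Injection.to f h ∷ U) js js! suc≤6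
                       (λ k → good k ∘ there))
    τj : τ j ≡ Injection.to f h
    τj = trans (others j (All¬⇒¬Any j∉js)) (updateAt-updates j τ₀)

  jobList : Assignment → ℕ → List (Fin N)
  jobList σ i = filter (λ j → σ j ℕ.≟ i) (allFin N)

  jobList-unique : ∀ σ i → Unique (jobList σ i)
  jobList-unique σ i = Unique.filter⁺ (λ j → σ j ℕ.≟ i) (Unique.allFin⁺ N)

  length-jobList : ∀ σ i → length (jobList σ i) ≡ ∣ jobs σ i ∣
  length-jobList σ i = length-filter-tabulate (λ j → σ j ℕ.≟ i) id

  ∈-jobList⁺ : ∀ σ {i j} → σ j ≡ i → j ∈ jobList σ i
  ∈-jobList⁺ σ {i} {j} = ∈-filter⁺ (λ j → σ j ℕ.≟ i) (∈-allFin j)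

  ∈-jobList⁻ : ∀ σ {i j} → j ∈ jobList σ i → σ j ≡ i
  ∈-jobList⁻ σ {i} = proj₂ ∘ ∈-filter⁻ (λ j → σ j ℕ.≟ i) {xs = allFin N}

  Medium⇒length≤4 : ∀ σ {i} → Medium σ i → length (jobList σ i) ≤ 4
  Medium⇒length≤4 σ {i} (_ , ≤4) = ℕ.≤-trans (ℕ.≤-reflexive (length-jobList σ i)) ≤4

  module _ {σ : Assignment} (terminal : Terminal σ) where

    terminal₁ : ∀ j {i} → Purchased σ i → i < σ j → ¬ Fits σ j i
    terminal₁ j {i} bought i<σj fits = terminal (updateAt σ j (const i))
      (op₁ j i bought i<σj fits (updateAt-updates j σ) (λ k k≢j → updateAt-minimal k j σ k≢j))

    terminal₂ : ∀ {i} → Medium σ i → ¬ (∀ j → σ j ≡ i → Good σ j)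
    terminal₂ {i} medium good = terminal τ (op₂ i medium good
        ((λ j → host j ∘ ∈-jobList⁺ σ) , λ j k σj σk → distinct j k (∈-jobList⁺ σ σj) (∈-jobList⁺ σ σk))
        (λ j σj≢i → others j (σj≢i ∘ ∈-jobList⁻ σ)))
      where
      open Scattering (scatter σ σ [] (jobList σ i) (jobList-unique σ i)
        (ℕ.≤-trans (Medium⇒length≤4 σ medium) (ℕ.m≤m+n 4 2)) (λ j → good j ∘ ∈-jobList⁻ σ))

    -- Job `j` claims its host `i′` first; with `i′` blocked there are still enough hosts for the
    -- other good jobs, of which there are at most three.
    terminal₃ : ∀ {i j} → Medium σ i → σ j ≡ i → OthersGood σ i j → ¬ FitsSomeA₁ σ j
    terminal₃ {i} {j} medium σj good fits@(i′ , i′∈A₁ , j-fits) =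
      terminal τ (op₃ i j medium σj fits good (hosts , apart) stay)
      where
      Rest? = λ k → (σ k ℕ.≟ i) ×-dec ¬? (k Fin.≟ j)
      rest = filter Rest? (allFin N)
      rest⁻ : ∀ {k} → k ∈ rest → σ k ≡ i × k ≢ j
      rest⁻ = proj₂ ∘ ∈-filter⁻ Rest? {xs = allFin N}
      rest⁺ : ∀ {k} → σ k ≡ i → k ≢ j → k ∈ rest
      rest⁺ {k} σk k≢j = ∈-filter⁺ Rest? (∈-allFin k) (σk , k≢j)
      1+rest≤4 : 1 + length rest ≤ 4
      1+rest≤4 = ℕ.≤-trans
        (unique-⊆⇒length≤ (¬Any⇒All¬ _ (λ j∈ → proj₂ (rest⁻ j∈) refl) ∷ Unique.filter⁺ Rest? (Unique.allFin⁺ N))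
          λ where
            (here refl) → ∈-jobList⁺ σ σj
            (there k∈)  → ∈-jobList⁺ σ (proj₁ (rest⁻ k∈)))
        (Medium⇒length≤4 σ medium)
      open Scattering (scatter σ (updateAt σ j (const i′)) [ i′ ] rest (Unique.filter⁺ Rest? (Unique.allFin⁺ N))
        (ℕ.≤-trans 1+rest≤4 (ℕ.m≤m+n 4 2)) (λ k k∈ → good k (proj₁ (rest⁻ k∈)) (proj₂ (rest⁻ k∈))))
      τj : τ j ≡ i′
      τj = trans (others j (λ j∈ → proj₂ (rest⁻ j∈) refl)) (updateAt-updates j σ)
      hosts : ∀ k → σ k ≡ i → A₁ σ (τ k) × Fits σ k (τ k)
      hosts k σk with k Fin.≟ j
      ... | yes refl rewrite τj = i′∈A₁ , j-fits
      ... | no  k≢j = host k (rest⁺ σk k≢j)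
      apart : ∀ k l → σ k ≡ i → σ l ≡ i → τ k ≡ τ l → k ≡ l
      apart k l σk σl eq with k Fin.≟ j | l Fin.≟ j
      ... | yes refl | yes refl = refl
      ... | yes refl | no  l≢j  = contradiction (here (trans (sym eq) τj)) (avoids l (rest⁺ σl l≢j))
      ... | no  k≢j  | yes refl = contradiction (here (trans eq τj)) (avoids k (rest⁺ σk k≢j))
      ... | no  k≢j  | no  l≢j  = distinct k l (rest⁺ σk k≢j) (rest⁺ σl l≢j) eq
      stay : ∀ k → σ k ≢ i → τ k ≡ σ k
      stay k σk≢i = trans (others k (σk≢i ∘ proj₁ ∘ rest⁻)) (updateAt-minimal k j σ λ { refl → σk≢i σj })

    terminal₄ : ∀ {i₁ i₂ j₁ j₂} → i₁ ≢ i₂ → CriticalVia σ i₁ j₁ → CriticalVia σ i₂ j₂ →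
                ¬ Feasible (⁅ j₁ ⁆ ∪ ⁅ j₂ ⁆)
    terminal₄ {i₁} {i₂} {j₁} {j₂} i₁≢i₂ crit₁@(medium₁ , σj₁ , _ , good₁)
              crit₂@(medium₂ , σj₂ , _ , good₂) pair-feasible =
      terminal τ (op₄ i₁ i₂ j₁ j₂ new i₁≢i₂ crit₁ crit₂ pair-feasible unused τj₁ τj₂
        ((λ k → host k ∘ rest⁺) , λ k l Pk Pl → distinct k l (rest⁺ Pk) (rest⁺ Pl))
        stay)
      where
      -- An identifier above all those in use.
      new = suc (max 0 (machines σ))
      unused : ¬ Purchased σ new
      unused bought = ℕ.<-irrefl refl (All.lookup (xs≤max 0 (machines σ)) (∈-machines⁺ bought))
      Rest? = λ k → ((σ k ℕ.≟ i₁) ⊎-dec (σ k ℕ.≟ i₂)) ×-dec ¬? (k Fin.≟ j₁) ×-dec ¬? (k Fin.≟ j₂)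
      rest = filter Rest? (allFin N)
      rest⁻ : ∀ {k} → k ∈ rest → (σ k ≡ i₁ ⊎ σ k ≡ i₂) × k ≢ j₁ × k ≢ j₂
      rest⁻ = proj₂ ∘ ∈-filter⁻ Rest? {xs = allFin N}
      rest⁺ : ∀ {k} → (σ k ≡ i₁ ⊎ σ k ≡ i₂) × k ≢ j₁ × k ≢ j₂ → k ∈ rest
      rest⁺ {k} = ∈-filter⁺ Rest? (∈-allFin k)
      j₁≢j₂ : j₁ ≢ j₂
      j₁≢j₂ refl = i₁≢i₂ (trans (sym σj₁) σj₂)
      2+rest≤8 : 2 + length rest ≤ 2 + 6
      -- Two machines of at most four jobs each, less `j₁` and `j₂`, leave at most six jobs, the
      -- number of hosts guaranteed to each good job.
      2+rest≤8 = ℕ.≤-trans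
        (unique-⊆⇒length≤ {xs = j₁ ∷ j₂ ∷ rest} {ys = jobList σ i₁ ++ jobList σ i₂}
          ((j₁≢j₂ ∷ ¬Any⇒All¬ _ (λ j∈ → proj₁ (proj₂ (rest⁻ j∈)) refl))
            ∷ ¬Any⇒All¬ _ (λ j∈ → proj₂ (proj₂ (rest⁻ j∈)) refl)
            ∷ Unique.filter⁺ Rest? (Unique.allFin⁺ N))
          λ where
            (here refl)         → ∈-++⁺ˡ (∈-jobList⁺ σ σj₁)
            (there (here refl)) → ∈-++⁺ʳ (jobList σ i₁) (∈-jobList⁺ σ σj₂)
            (there (there k∈))  →
              [ ∈-++⁺ˡ ∘ ∈-jobList⁺ σ , ∈-++⁺ʳ (jobList σ i₁) ∘ ∈-jobList⁺ σ ]′ (proj₁ (rest⁻ k∈)))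
        (ℕ.≤-trans (ℕ.≤-reflexive (length-++ (jobList σ i₁)))
          (ℕ.+-mono-≤ (Medium⇒length≤4 σ medium₁) (Medium⇒length≤4 σ medium₂)))
      good : ∀ k → k ∈ rest → Good σ k
      good k k∈ with rest⁻ k∈
      ... | inj₁ σk , k≢j₁ , _ = good₁ k σk k≢j₁
      ... | inj₂ σk , _ , k≢j₂ = good₂ k σk k≢j₂
      τ₁ = updateAt σ j₁ (const new)
      open Scattering (scatter σ (updateAt τ₁ j₂ (const new)) [] rest (Unique.filter⁺ Rest? (Unique.allFin⁺ N))
        (ℕ.+-cancelˡ-≤ 2 _ _ 2+rest≤8) good)
      τj₁ : τ j₁ ≡ new
      τj₁ = trans (others j₁ (λ j∈ → proj₁ (proj₂ (rest⁻ j∈)) refl))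
        (trans (updateAt-minimal j₁ j₂ τ₁ j₁≢j₂) (updateAt-updates j₁ σ))
      τj₂ : τ j₂ ≡ new
      τj₂ = trans (others j₂ (λ j∈ → proj₂ (proj₂ (rest⁻ j∈)) refl)) (updateAt-updates j₂ τ₁)
      stay : ∀ k → σ k ≢ i₁ × σ k ≢ i₂ → τ k ≡ σ k
      stay k (≢i₁ , ≢i₂) = trans (others k ([ ≢i₁ , ≢i₂ ]′ ∘ proj₁ ∘ rest⁻))
        (trans (updateAt-minimal k j₂ τ₁ λ { refl → ≢i₂ σj₂ }) (updateAt-minimal k j₁ σ λ { refl → ≢i₁ σj₁ }))

-- Sums over lists of machines

module ListSums {c ℓ₁ ℓ₂ ℓ₃} (F : EuclideanField c ℓ₁ ℓ₂ ℓ₃) where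
  open EuclideanFieldProperties F hiding (refl; sym; trans; _+_; _*_; _≤_; _<_)
  open EuclideanField F using () renaming
    (_+_ to _⊕_; _≤_ to _≼_; _<_ to _≺_; refl to ≈-refl; sym to ≈-sym; trans to ≈-trans)
  open Sum +-commutativeMonoid using (∑-distrib-+; sum-replicate-zero)
  private module R = CommutativeRing commutativeRing
  open import Relation.Binary.Reasoning.Setoid R.setoid

  ∑∈L : List ℕ → (ℕ → Carrier) → Carrier
  ∑∈L []      f = 0#
  ∑∈L (i ∷ L) f = f i ⊕ ∑∈L L f

  ∑∈L-cong : ∀ L {f g} → (∀ i → f i ≈ g i) → ∑∈L L f ≈ ∑∈L L g
  ∑∈L-cong []      f≈g = ≈-refl
  ∑∈L-cong (i ∷ L) f≈g = R.+-cong (f≈g i) (∑∈L-cong L f≈g)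

  ∑∈L-mono : ∀ L {f g} → (∀ {i} → i ∈ L → f i ≼ g i) → ∑∈L L f ≼ ∑∈L L g
  ∑∈L-mono []      f≤g = ≤-refl
  ∑∈L-mono (i ∷ L) f≤g = +-mono-≤ (f≤g (here refl)) (∑∈L-mono L (f≤g ∘ there))

  ∑∈L-const : ∀ L x → ∑∈L L (const x) ≈ length L · x
  ∑∈L-const []      x = ≈-refl
  ∑∈L-const (i ∷ L) x = R.+-congˡ (∑∈L-const L x)

  ∑∈L-swap : ∀ L {n} (f : ℕ → Vector Carrier n) →
             ∑∈L L (λ i → EuclideanField.sum F (f i)) ≈ EuclideanField.sum F (λ j → ∑∈L L (λ i → f i j))
  ∑∈L-swap []      {n} f = ≈-sym (sum-replicate-zero n)
  ∑∈L-swap (i ∷ L) f = ≈-trans (R.+-congˡ (∑∈L-swap L f)) (≈-sym (∑-distrib-+ (f i) _))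

  ∑∈L-indicator-∉ : ∀ {L i} x → i ∉ L → ∑∈L L (λ i′ → if does (i ℕ.≟ i′) then x else 0#) ≈ 0#
  ∑∈L-indicator-∉ {[]}     x i∉ = ≈-refl
  ∑∈L-indicator-∉ {i′ ∷ L} {i} x i∉ rewrite dec-false (i ℕ.≟ i′) (i∉ ∘ here) =
    ≈-trans (R.+-identityˡ _) (∑∈L-indicator-∉ x (i∉ ∘ there))

  ∑∈L-indicator : ∀ {L i} x → Unique L → i ∈ L →
                  ∑∈L L (λ i′ → if does (i ℕ.≟ i′) then x else 0#) ≈ x
  ∑∈L-indicator {i ∷ L} x (i∉L ∷ _) (here refl) rewrite dec-true (i ℕ.≟ i) refl =
    ≈-trans (R.+-congˡ (∑∈L-indicator-∉ x (All¬⇒¬Any i∉L))) (R.+-identityʳ x)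
  ∑∈L-indicator {i′ ∷ L} {i} x (i′∉L ∷ L!) (there i∈L)
    rewrite dec-false (i ℕ.≟ i′) (λ i≡i′ → All.lookup i′∉L i∈L (sym i≡i′)) =
    ≈-trans (R.+-identityˡ _) (∑∈L-indicator x L! i∈L)

  -- Counts by an explicit list of witnesses, since `P` may be undecidable.
  Many : ∀ {p} → (ℕ → Set p) → List ℕ → ℕ → Set p
  Many P L n = ∃[ ys ] Unique ys × All (_∈ L) ys × All P ys × length ys ≡ n

  Many-there : ∀ {p} {P : ℕ → Set p} {i L n} → Many P L n → Many P (i ∷ L) n
  Many-there (ys , ys! , ys⊆ , Pys , len) = ys , ys! , All.map there ys⊆ , Pys , len

  Many-∷ : ∀ {p} {P : ℕ → Set p} {i L n} → All (i ≢_) L → P i → Many P L n → Many P (i ∷ L) (suc n)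
  Many-∷ i∉L Pi (ys , ys! , ys⊆ , Pys , len) =
    _ ∷ ys , All.map (All.lookup i∉L) ys⊆ ∷ ys! , here refl ∷ All.map there ys⊆ , Pi ∷ Pys , cong suc len

  -- Each of the at most `n` exceptions is charged one `x`. Cases on `P i` may be distinguished
  -- because the conclusion is a negation.
  all-but : ∀ {p} (P : ℕ → Set p) n {L f x} → Unique L → 0# ≼ x → (∀ i → 0# ≼ f i) →
            (∀ {i} → i ∈ L → ¬ P i → x ≼ f i) → ¬ Many P L (suc n) →
            length L · x ≼ ∑∈L L f ⊕ n · x
  all-but P n {[]} _ 0≤x 0≤f x≤f few = +-nonneg ≤-refl (·-nonneg n 0≤x)
  all-but P n {i ∷ L} {f} {x} (i∉L ∷ L!) 0≤x 0≤f x≤f few = by-cases (P i) (exceptional n few) ordinary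
    where
    rest : ∀ n → ¬ Many P L (suc n) → length L · x ≼ ∑∈L L f ⊕ n · x
    rest n = all-but P n L! 0≤x 0≤f (x≤f ∘ there)
    exceptional : ∀ n → ¬ Many P (i ∷ L) (suc n) → P i → suc (length L) · x ≼ ∑∈L (i ∷ L) f ⊕ n · x
    exceptional zero    few Pi = contradiction (Many-∷ i∉L Pi ([] , [] , [] , [] , refl)) few
    exceptional (suc n) few Pi = ≤-trans
      (+-monoʳ-≤ x (≤-trans (rest n (few ∘ Many-∷ i∉L Pi)) (+-monoˡ-≤ _ (x≤y+x (0≤f i)))))
      (≤-reflexive (≈-trans (≈-sym (R.+-assoc _ _ _)) (≈-trans (R.+-congʳ (R.+-comm _ _)) (R.+-assoc _ _ _))))
    ordinary : ¬ P i → suc (length L) · x ≼ ∑∈L (i ∷ L) f ⊕ n · x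
    ordinary ¬Pi = ≤-trans (+-mono-≤ (x≤f (here refl) ¬Pi) (rest n (few ∘ Many-there)))
      (≤-reflexive (≈-sym (R.+-assoc _ _ _)))

  -- Takes the place of filtering for a predicate that may be undecidable, such as criticality; it
  -- is obtained under double negation.
  record Splitting {p} (P : ℕ → Set p) (L : List ℕ) : Set (c ⊔ ℓ₁ ⊔ p) where
    field
      ins outs    : List ℕ
      ins-unique  : Unique ins
      outs-unique : Unique outs
      ins-P       : ∀ {i} → i ∈ ins → P i
      outs-¬P     : ∀ {i} → i ∈ outs → ¬ P i
      ins-⊆       : ∀ {i} → i ∈ ins → i ∈ L
      outs-⊆      : ∀ {i} → i ∈ outs → i ∈ L
      length-+    : length L ≡ length ins ℕ.+ length outs
      ∑-+         : ∀ f → ∑∈L L f ≈ ∑∈L ins f ⊕ ∑∈L outs f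

  ¬¬-split : ∀ {p} (P : ℕ → Set p) {L} → Unique L → ¬ ¬ Splitting P L
  ¬¬-split P [] k = k record
    { ins = [] ; outs = [] ; ins-unique = [] ; outs-unique = [] ; ins-P = λ () ; outs-¬P = λ ()
    ; ins-⊆ = id ; outs-⊆ = id ; length-+ = refl ; ∑-+ = λ _ → ≈-sym (R.+-identityˡ 0#) }
  ¬¬-split P {i ∷ L} (i∉L ∷ L!) k = ¬¬-split P L! λ s → let open Splitting s in by-cases (P i)
    (λ Pi k → k record
      { ins         = i ∷ ins
      ; outs        = outs
      ; ins-unique  = All.tabulate (All.lookup i∉L ∘ ins-⊆) ∷ ins-unique
      ; outs-unique = outs-unique
      ; ins-P       = λ { (here refl) → Pi ; (there i∈) → ins-P i∈ }
      ; outs-¬P     = outs-¬P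
      ; ins-⊆       = λ { (here refl) → here refl ; (there i∈) → there (ins-⊆ i∈) }
      ; outs-⊆      = there ∘ outs-⊆
      ; length-+    = cong suc length-+
      ; ∑-+         = λ f → ≈-trans (R.+-congˡ (∑-+ f)) (≈-sym (R.+-assoc _ _ _))
      })
    (λ ¬Pi k → k record
      { ins         = ins
      ; outs        = i ∷ outs
      ; ins-unique  = ins-unique
      ; outs-unique = All.tabulate (All.lookup i∉L ∘ outs-⊆) ∷ outs-unique
      ; ins-P       = ins-P
      ; outs-¬P     = λ { (here refl) → ¬Pi ; (there i∈) → outs-¬P i∈ }
      ; ins-⊆       = there ∘ ins-⊆
      ; outs-⊆      = λ { (here refl) → here refl ; (there i∈) → there (outs-⊆ i∈) }
      ; length-+    = trans (cong suc length-+) (sym (ℕ.+-suc (length ins) (length outs)))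
      ; ∑-+         = λ f → ≈-trans (R.+-congˡ (∑-+ f)) (≈-trans (≈-sym (R.+-assoc _ _ _))
                        (≈-trans (R.+-congʳ (R.+-comm _ _)) (R.+-assoc _ _ _)))
      }) k

  -- Supplies the least weight of a job that is not good. The double negation makes up for `P` and
  -- the order being undecidable.
  ¬¬-min : ∀ {n p} (P : Fin n → Set p) (f : Vector Carrier n) →
           ¬ ¬ ((∀ k → ¬ P k) ⊎ ∃[ k ] P k × ∀ l → P l → f k ≼ f l)
  ¬¬-min {zero}  P f k = k (inj₁ λ ())
  ¬¬-min {suc n} P f k = by-cases (P zero) (λ P0 _ → ¬¬-min (P ∘ suc) (f ∘ suc) λ where
      (inj₁ none) → k (inj₂ (zero , P0 , λ { zero _ → ≤-refl ; (suc l) Pl → contradiction Pl (none l) }))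
      (inj₂ (m , Pm , least)) → ≤-total {f zero} {f (suc m)} λ where
        (inj₁ 0≤m) → k (inj₂ (zero , P0 , λ { zero _ → ≤-refl ; (suc l) Pl → ≤-trans 0≤m (least l Pl) }))
        (inj₂ m≤0) → k (inj₂ (suc m , Pm , λ { zero _ → m≤0 ; (suc l) Pl → least l Pl })))
    (λ ¬P0 _ → ¬¬-min (P ∘ suc) (f ∘ suc) λ where
      (inj₁ none) → k (inj₁ λ { zero → ¬P0 ; (suc l) → none l })
      (inj₂ (m , Pm , least)) →
        k (inj₂ (suc m , Pm , λ { zero P0 → contradiction P0 ¬P0 ; (suc l) Pl → least l Pl })))
    k

  ∑∈-single : ∀ {n} {S : Subset n} {f : Vector Carrier n} → (∀ j → 0# ≼ f j) →
              ∀ {k} → k ∈ₛ S → f k ≼ ∑∈ S f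
  ∑∈-single {S = S} {f} 0≤f {k} k∈ = ≤-trans (≤-reflexive (≈-sym (∑∈-⁅⁆ k f)))
    (∑∈-mono 0≤f λ {l} l∈ → subst (_∈ₛ S) (sym (Subset.x∈⁅y⁆⇒x≡y k l∈)) k∈)

  ∑∈-pair : ∀ {n} {S : Subset n} {f : Vector Carrier n} → (∀ j → 0# ≼ f j) →
            ∀ {k l} → k ≢ l → k ∈ₛ S → l ∈ₛ S → f k ⊕ f l ≼ ∑∈ S f
  ∑∈-pair 0≤f {zero}  {zero}  k≢l _ _ = contradiction refl k≢l
  ∑∈-pair 0≤f {zero}  {suc l} k≢l Vec.here (Vec.there l∈) = +-monoʳ-≤ _ (∑∈-single (0≤f ∘ suc) l∈)
  ∑∈-pair 0≤f {suc k} {zero}  k≢l (Vec.there k∈) Vec.here = ≤-trans (≤-reflexive (R.+-comm _ _))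
    (+-monoʳ-≤ _ (∑∈-single (0≤f ∘ suc) k∈))
  ∑∈-pair {S = s Vec.∷ S} {f} 0≤f {suc k} {suc l} k≢l (Vec.there k∈) (Vec.there l∈) =
    ≤-trans (∑∈-pair (0≤f ∘ suc) (k≢l ∘ cong suc) k∈ l∈) (x≤y+x (head s))
    where
    head : ∀ s → 0# ≼ (if s then f zero else 0#)
    head true  = 0≤f zero
    head false = ≤-refl

-- The counting argument

-- The exceptional machines account for 33 in the coefficient of `p` and 30 in that of `q`; both are
-- to be exceeded by one. The `q` part spends `a + c ≤ O` twice.
coefficients-exceed : ∀ a l c m O → a + c ≤ O → 2 * O + 12 ≤ a + (l + (c + m)) →
  O * 8 + 34 ≤ a * 4 + (l * 5 + (c * 4 + m * 4)) × O * 8 + 31 ≤ a * 3 + (l * 5 + (c * 4 + m * 6))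
coefficients-exceed a l c m O a+c≤O many = p-coefficient , q-coefficient
  where
  open ℕ.≤-Reasoning
  open +-*-Solver
  p-coefficient = begin
    O * 8 + 34                            ≤⟨ ℕ.+-monoʳ-≤ (O * 8) (ℕ.m≤m+n 34 14) ⟩
    O * 8 + 48                            ≡⟨ solve 1 (λ O → O :* con 8 :+ con 48
      := con 4 :* (con 2 :* O :+ con 12)) refl O ⟩
    4 * (2 * O + 12)                      ≤⟨ ℕ.*-monoʳ-≤ 4 many ⟩
    4 * (a + (l + (c + m)))               ≤⟨ ℕ.m≤m+n _ l ⟩
    4 * (a + (l + (c + m))) + l           ≡⟨ solve 4 (λ a l c m → con 4 :* (a :+ (l :+ (c :+ m))) :+ l :=
      a :* con 4 :+ (l :* con 5 :+ (c :* con 4 :+ m :* con 4))) refl a l c m ⟩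
    a * 4 + (l * 5 + (c * 4 + m * 4))     ∎
  q-coefficient = ℕ.+-cancelʳ-≤ (2 * O) _ _ (begin
    O * 8 + 31 + 2 * O                    ≤⟨ ℕ.+-monoˡ-≤ (2 * O) (ℕ.+-monoʳ-≤ (O * 8) (ℕ.m≤m+n 31 29)) ⟩
    O * 8 + 60 + 2 * O                    ≡⟨ solve 1 (λ O → O :* con 8 :+ con 60 :+ con 2 :* O
      := con 5 :* (con 2 :* O :+ con 12)) refl O ⟩
    5 * (2 * O + 12)                      ≤⟨ ℕ.*-monoʳ-≤ 5 many ⟩
    5 * (a + (l + (c + m)))               ≤⟨ ℕ.m≤m+n _ (c + m) ⟩
    5 * (a + (l + (c + m))) + (c + m)     ≡⟨ solve 4 (λ a l c m → con 5 :* (a :+ (l :+ (c :+ m))) :+ (c :+ m) :=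
      a :* con 3 :+ (l :* con 5 :+ (c :* con 4 :+ m :* con 6)) :+ con 2 :* (a :+ c)) refl a l c m ⟩
    a * 3 + (l * 5 + (c * 4 + m * 6)) + 2 * (a + c)
      ≤⟨ ℕ.+-monoʳ-≤ (a * 3 + (l * 5 + (c * 4 + m * 6))) (ℕ.*-monoʳ-≤ 2 a+c≤O) ⟩
    a * 3 + (l * 5 + (c * 4 + m * 6)) + 2 * O  ∎)

module Combination {c ℓ₁ ℓ₂ ℓ₃} (F : EuclideanField c ℓ₁ ℓ₂ ℓ₃) where
  open EuclideanFieldProperties F hiding (refl; sym; trans; _+_; _*_; _≤_; _<_)
  open EuclideanField F using () renaming
    (_+_ to _⊕_; _≤_ to _≼_; _<_ to _≺_; refl to ≈-refl; sym to ≈-sym; trans to ≈-trans)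
  private module R = CommutativeRing commutativeRing
  open ≤-Reasoning

  -- With p = 8 s - 3 and q = 4 - 8 s, where the units are as at the top, all
  -- thresholds are combinations of p and q with natural coefficients: 8 s is
  -- 4 p + 3 q, and 12 - 16 s is 4 p + 6 q.  So no subtraction is needed, and the
  -- coefficients of p and q can be compared separately.
  module _ {p q : Carrier} (0≤p : 0# ≼ p) (0≤q : 0# ≼ q) where

    ⟪_,_⟫ : ℕ → ℕ → Carrier
    ⟪ i , j ⟫ = i · p ⊕ j · q

    ⟪⟫-+ : ∀ i j i′ j′ → ⟪ i , j ⟫ ⊕ ⟪ i′ , j′ ⟫ ≈ ⟪ i + i′ , j + j′ ⟫
    ⟪⟫-+ i j i′ j′ = ≈-trans (interchange _ _ _ _)
      (R.+-cong (≈-sym (×-homo-+ p i i′)) (≈-sym (×-homo-+ q j j′)))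

    ⟪⟫-· : ∀ n i j → n · ⟪ i , j ⟫ ≈ ⟪ n * i , n * j ⟫
    ⟪⟫-· n i j = ≈-trans (×-distrib-+ _ _ n) (R.+-cong (×-assocˡ p n i) (×-assocˡ q n j))

    ⟪⟫-mono : ∀ {i j i′ j′} → i ≤ i′ → j ≤ j′ → ⟪ i , j ⟫ ≼ ⟪ i′ , j′ ⟫
    ⟪⟫-mono i≤i′ j≤j′ = +-mono-≤ (·-monoˡ-≤ 0≤p i≤i′) (·-monoˡ-≤ 0≤q j≤j′)

    -- With more than `2 * O + 11` machines, the sum of the four bounds would exceed what `W` and
    -- the exceptions allow by at least one in each coefficient, that is by `p ⊕ q`, forcing
    -- `Θ ≼ 0#`.
    counting : ∀ {Θ} → 0# ≺ Θ → Θ ≈ p ⊕ q → ∀ {wₐ wₗ wᵢ wₘ} a l c m O →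
      a · ⟪ 4 , 3 ⟫ ≼ wₐ ⊕ 5 · ⟪ 4 , 3 ⟫ →
      l · (5 · Θ) ≼ wₗ ⊕ 1 · (5 · Θ) →
      c · (4 · Θ) ≼ wᵢ ⊕ 1 · (4 · Θ) →
      m · ⟪ 4 , 6 ⟫ ≼ wₘ ⊕ 1 · ⟪ 4 , 6 ⟫ →
      wₐ ⊕ (wₗ ⊕ (wᵢ ⊕ wₘ)) ≼ O · (8 · Θ) →
      a + c ≤ O → a + (l + (c + m)) ≤ 2 * O + 11
    counting {Θ} 0<Θ Θ≈p+q {wₐ} {wₗ} {wᵢ} {wₘ} a l c m O Wa Wl Wc Wm W a+c≤O =
      ℕ.≮⇒≥ λ 2O+11<n → impossible (coefficients-exceed a l c m O a+c≤O
        (ℕ.≤-trans (ℕ.≤-reflexive (ℕ.+-suc (2 * O) 11)) 2O+11<n))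
      where
      kΘ : ∀ k → k · Θ ≈ ⟪ k , k ⟫
      kΘ k = ≈-trans (×-congʳ k Θ≈p+q) (×-distrib-+ p q k)

      bound : ∀ {w x i j} n k → x ≈ ⟪ i , j ⟫ → n · x ≼ w ⊕ k · x → ⟪ n * i , n * j ⟫ ≼ w ⊕ ⟪ k * i , k * j ⟫
      bound {w} {x} {i} {j} n k x≈ nx≤ = begin
        ⟪ n * i , n * j ⟫          ≈⟨ ⟪⟫-· n i j ⟨
        n · ⟪ i , j ⟫              ≈⟨ ×-congʳ n x≈ ⟨
        n · x                      ≲⟨ nx≤ ⟩
        w ⊕ k · x                  ≈⟨ R.+-congˡ (≈-trans (×-congʳ k x≈) (⟪⟫-· k i j)) ⟩
        w ⊕ ⟪ k * i , k * j ⟫      ∎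

      add : ∀ {w w′ i j i′ j′ k l k′ l′} → ⟪ i , j ⟫ ≼ w ⊕ ⟪ k , l ⟫ → ⟪ i′ , j′ ⟫ ≼ w′ ⊕ ⟪ k′ , l′ ⟫ →
            ⟪ i + i′ , j + j′ ⟫ ≼ (w ⊕ w′) ⊕ ⟪ k + k′ , l + l′ ⟫
      add {w} {w′} {i} {j} {i′} {j′} {k} {l} {k′} {l′} ≤₁ ≤₂ = begin
        ⟪ i + i′ , j + j′ ⟫                            ≈⟨ ⟪⟫-+ i j i′ j′ ⟨
        ⟪ i , j ⟫ ⊕ ⟪ i′ , j′ ⟫                        ≲⟨ +-mono-≤ ≤₁ ≤₂ ⟩
        (w ⊕ ⟪ k , l ⟫) ⊕ (w′ ⊕ ⟪ k′ , l′ ⟫)           ≈⟨ interchange _ _ _ _ ⟩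
        (w ⊕ w′) ⊕ (⟪ k , l ⟫ ⊕ ⟪ k′ , l′ ⟫)           ≈⟨ R.+-congˡ (⟪⟫-+ k l k′ l′) ⟩
        (w ⊕ w′) ⊕ ⟪ k + k′ , l + l′ ⟫                 ∎

      impossible : ¬ (O * 8 + 34 ≤ a * 4 + (l * 5 + (c * 4 + m * 4)) × O * 8 + 31 ≤ a * 3 + (l * 5 + (c * 4 + m * 6)))
      impossible (p≤ , q≤) = contradiction 0<Θ (+-cancelʳ-≤ ⟪ O * 8 + 33 , O * 8 + 30 ⟫ (begin
        Θ ⊕ ⟪ O * 8 + 33 , O * 8 + 30 ⟫
          ≈⟨ R.+-congʳ (≈-trans (≈-sym (R.+-identityʳ Θ)) (kΘ 1)) ⟩
        ⟪ 1 , 1 ⟫ ⊕ ⟪ O * 8 + 33 , O * 8 + 30 ⟫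
          ≈⟨ ⟪⟫-+ 1 1 (O * 8 + 33) (O * 8 + 30) ⟩
        ⟪ 1 + (O * 8 + 33) , 1 + (O * 8 + 30) ⟫
          ≲⟨ ⟪⟫-mono {1 + (O * 8 + 33)} {1 + (O * 8 + 30)} (ℕ.≤-trans (ℕ.≤-reflexive (sym (ℕ.+-suc (O * 8) 33))) p≤)
                     (ℕ.≤-trans (ℕ.≤-reflexive (sym (ℕ.+-suc (O * 8) 30))) q≤) ⟩
        ⟪ a * 4 + (l * 5 + (c * 4 + m * 4)) , a * 3 + (l * 5 + (c * 4 + m * 6)) ⟫
          -- Five exceptions of `⟪ 4 , 3 ⟫` make `⟪ 20 , 15 ⟫`; one each of `⟪ 5 , 5 ⟫`, `⟪ 4 , 4 ⟫`
          -- and `⟪ 4 , 6 ⟫` make `⟪ 13 , 15 ⟫`.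
          ≲⟨ add {i = a * 4} {a * 3} {l * 5 + (c * 4 + m * 4)} {l * 5 + (c * 4 + m * 6)} {20} {15} {13} {15}
               (bound {i = 4} {3} a 5 ≈-refl Wa)
               (add {i = l * 5} {l * 5} {c * 4 + m * 4} {c * 4 + m * 6} {5} {5} {8} {10}
                 (bound {i = 5} {5} l 1 (kΘ 5) Wl)
                 (add {i = c * 4} {c * 4} {m * 4} {m * 6} {4} {4} {4} {6}
                   (bound {i = 4} {4} c 1 (kΘ 4) Wc) (bound {i = 4} {6} m 1 ≈-refl Wm))) ⟩
        (wₐ ⊕ (wₗ ⊕ (wᵢ ⊕ wₘ))) ⊕ ⟪ 33 , 30 ⟫
          ≲⟨ +-monoˡ-≤ _ W ⟩
        O · (8 · Θ) ⊕ ⟪ 33 , 30 ⟫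
          ≈⟨ R.+-congʳ (≈-trans (×-congʳ O (kΘ 8)) (⟪⟫-· O 8 8)) ⟩
        ⟪ O * 8 , O * 8 ⟫ ⊕ ⟪ 33 , 30 ⟫
          ≈⟨ ⟪⟫-+ (O * 8) (O * 8) 33 30 ⟩
        ⟪ O * 8 + 33 , O * 8 + 30 ⟫
          ≈⟨ R.+-identityˡ _ ⟨
        0# ⊕ ⟪ O * 8 + 33 , O * 8 + 30 ⟫ ∎))

-- Loads and mutually exclusive jobs in a terminal assignment.

module Counting {c ℓ₁ ℓ₂ ℓ₃} {F : EuclideanField c ℓ₁ ℓ₂ ℓ₃} {N : ℕ} (I : SMBP F N) where
  open EuclideanFieldProperties F hiding (refl; sym; trans; _+_; _*_; _≤_; _<_)
  open EuclideanField F using () renaming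
    (_+_ to _⊕_; _≤_ to _≼_; _<_ to _≺_; refl to ≈-refl; sym to ≈-sym; trans to ≈-trans)
  open ListSums F
  open LocalSearch I
  open SMBP I using (Feasible)
  open Weights I
  open LocalSearchProperties I
  open TerminalProperties I
  private module R = CommutativeRing commutativeRing
  open ≤-Reasoning

  load : Assignment → ℕ → Carrier
  load σ i = ω (jobs σ i)

  load-nonneg : ∀ σ i → 0# ≼ load σ i
  load-nonneg σ i = ∑∈-nonneg (jobs σ i) weight-nonneg

  total : Carrier
  total = EuclideanField.sum F weight

  -- Double counting, as every job lies on exactly one machine. The total does not depend on the
  -- assignment, so loads under `σ` are bounded through any feasible `ρ`.
  ∑load≈total : ∀ σ → ∑∈L (machines σ) (load σ) ≈ total
  ∑load≈total σ = ≈-trans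
    (∑∈L-swap (machines σ) (λ i j → if Vec.lookup (jobs σ i) j then weight j else 0#))
    (sum-cong-≋ λ j → ≈-trans
      (∑∈L-cong (machines σ) λ i → R.reflexive
        (cong (if_then weight j else 0#) (Vec.lookup∘tabulate (λ k → does (σ k ℕ.≟ i)) j)))
      (∑∈L-indicator (weight j) (machines-unique σ) (∈-machines⁺ (j , refl))))
    where open Sum +-commutativeMonoid using (sum-cong-≋)

  total≤ : ∀ {ρ} → FeasibleAssignment ρ → total ≼ #machines ρ · (8 · Θ)
  total≤ {ρ} feasible = begin
    total                               ≈⟨ ∑load≈total ρ ⟨
    ∑∈L (machines ρ) (load ρ)           ≲⟨ ∑∈L-mono (machines ρ) (λ i∈ →
                                             feasible⇒ω≤ (jobs ρ _) (feasible _ (∈-machines⁻ i∈))) ⟩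
    ∑∈L (machines ρ) (const (8 · Θ))    ≈⟨ ∑∈L-const (machines ρ) _ ⟩
    #machines ρ · (8 · Θ)               ∎

  misfit⇒≤ : ∀ S j → ¬ Feasible (S ∪ ⁅ j ⁆) → 6 · Θ ≼ ω S ⊕ weight j
  misfit⇒≤ S j infeasible = begin
    6 · Θ              ≲⟨ infeasible⇒≤ω (S ∪ ⁅ j ⁆) infeasible ⟩
    ω (S ∪ ⁅ j ⁆)      ≲⟨ ∑∈-∪ S ⁅ j ⁆ weight-nonneg ⟩
    ω S ⊕ ω ⁅ j ⁆      ≈⟨ R.+-congˡ (∑∈-⁅⁆ j weight) ⟩
    ω S ⊕ weight j     ∎

  A₁-jobs : ∀ σ {i j} → A₁ σ i → σ j ≡ i → jobs σ i ⊆ ⁅ j ⁆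
  A₁-jobs σ {i} {j} one σj {k} k∈ with k Fin.≟ j
  ... | yes refl = Subset.x∈⁅x⁆ k
  ... | no  k≢j  = contradiction
    (unique-⊆⇒length≤ {xs = k ∷ j ∷ []} ((k≢j ∷ []) ∷ [] ∷ []) λ where
      (here refl)         → ∈-jobList⁺ σ (∈-jobs⁻ σ k∈)
      (there (here refl)) → ∈-jobList⁺ σ σj)
    (ℕ.<⇒≱ (s≤s (ℕ.≤-reflexive (trans (length-jobList σ i) one))))

  ∪-monoˡ : ∀ {S T : Subset N} U → S ⊆ T → S ∪ U ⊆ T ∪ U
  ∪-monoˡ {S} {T} U S⊆T x∈ = Subset.x∈p∪q⁺ ([ inj₁ ∘ S⊆T , inj₂ ]′ (Subset.x∈p∪q⁻ S U x∈))

  Critical : Assignment → ℕ → Set ℓ₃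
  Critical σ i = ∃[ j ] CriticalVia σ i j

  module _ {σ : Assignment} (terminal : Terminal σ) where

    -- By operation (1), no job of `i` fits in the earlier machine `i′`; `misfit⇒≤` is added up over
    -- these jobs.
    later-loads : ∀ {i i′} → Purchased σ i′ → i′ < i →
                  ∣ jobs σ i ∣ · (6 · Θ) ≼ ∣ jobs σ i ∣ · load σ i′ ⊕ load σ i
    later-loads {i} {i′} bought i′<i = ∑∈-lower (jobs σ i) weight λ j j∈ →
      misfit⇒≤ (jobs σ i′) j (terminal₁ terminal j bought (subst (i′ <_) (sym (∈-jobs⁻ σ j∈)) i′<i))

    -- If `n` jobs are on `i` and both loads are below `t · Θ`, then `n · load σ i′ ⊕ load σ i` is
    -- below `(n + 1) t Θ ≤ 6 n Θ`, against `later-loads`.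
    ¬both-light : ∀ {i i′ t} → t * suc ∣ jobs σ i ∣ ≤ 6 * ∣ jobs σ i ∣ → Purchased σ i′ → i′ < i →
                  load σ i′ ≺ t · Θ → ¬ load σ i ≺ t · Θ
    ¬both-light {i} {i′} {t} t[1+n]≤6n bought i′<i light′ light =
      contradiction (+-monoˡ-< (n · (t · Θ)) light) (begin
        t · Θ ⊕ n · (t · Θ)             ≈⟨ ×-assocˡ Θ (suc n) t ⟩
        (suc n * t) · Θ                 ≲⟨ ·-monoˡ-≤ (<⇒≤ 0<Θ) (ℕ.≤-trans (ℕ.≤-reflexive (ℕ.*-comm (suc n) t))
                                             (ℕ.≤-trans t[1+n]≤6n (ℕ.≤-reflexive (ℕ.*-comm 6 n)))) ⟩
        (n * 6) · Θ                     ≈⟨ ×-assocˡ Θ n 6 ⟨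
        n · (6 · Θ)                     ≲⟨ later-loads bought i′<i ⟩
        n · load σ i′ ⊕ load σ i        ≲⟨ +-monoˡ-≤ _ (·-monoʳ-≤ n (<⇒≤ light′)) ⟩
        n · (t · Θ) ⊕ load σ i          ≈⟨ R.+-comm _ _ ⟩
        load σ i ⊕ n · (t · Θ)          ∎ )
      where n = ∣ jobs σ i ∣

    -- One exception suffices: of two light machines, the one with the larger identifier takes the
    -- role of `i` in `¬both-light`.
    heavy : ∀ t {L} → Unique L → (∀ {i} → i ∈ L → Purchased σ i) →
            (∀ {i} → i ∈ L → t * suc ∣ jobs σ i ∣ ≤ 6 * ∣ jobs σ i ∣) →
            length L · (t · Θ) ≼ ∑∈L L (load σ) ⊕ 1 · (t · Θ)
    heavy t {L} L! bought large = all-but (λ i → load σ i ≺ t · Θ) 1 L!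
      (·-nonneg t (<⇒≤ 0<Θ)) (load-nonneg σ) (λ _ → id) two-light
      where
      two-light : ¬ Many (λ i → load σ i ≺ t · Θ) L 2
      two-light (i ∷ i′ ∷ [] , (i≢i′ ∷ _) ∷ _ , i∈ ∷ i′∈ ∷ [] , light ∷ light′ ∷ [] , refl) with ℕ.<-cmp i i′
      ... | tri< i<i′ _ _ = ¬both-light {i′} {i} {t} (large i′∈) (bought i∈) i<i′ light light′
      ... | tri≈ _ i≡i′ _ = i≢i′ i≡i′
      ... | tri> _ _ i′<i = ¬both-light {i} {i′} {t} (large i∈) (bought i′∈) i′<i light′ light

    -- Such jobs j occupy pairwise distinct machines in every feasible assignment.
    Exclusive : ℕ → Fin N → Set ℓ₃
    Exclusive i j = (A₁ σ i × σ j ≡ i) ⊎ CriticalVia σ i j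

    -- Two jobs of A₁ machines are kept apart by operation (1), two critical ones by operation (4),
    -- and a mixed pair by the definition of critical.
    exclusive : ∀ {i i′ j j′} → i ≢ i′ → Exclusive i j → Exclusive i′ j′ → ¬ Feasible (⁅ j ⁆ ∪ ⁅ j′ ⁆)
    exclusive {i} {i′} {j} {j′} i≢i′ (inj₁ (one , σj)) (inj₁ (one′ , σj′)) pair with ℕ.<-cmp i i′
    ... | tri< i<i′ _ _ = terminal₁ terminal j′ (j , σj) (subst (i <_) (sym σj′) i<i′)
            (Feasible-antitone (∪-monoˡ ⁅ j′ ⁆ (A₁-jobs σ one σj)) pair)
    ... | tri≈ _ i≡i′ _ = i≢i′ i≡i′
    ... | tri> _ _ i′<i = terminal₁ terminal j (j′ , σj′) (subst (i′ <_) (sym σj) i′<i)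
            (Feasible-antitone (∪-monoˡ ⁅ j ⁆ (A₁-jobs σ one′ σj′))
              (subst Feasible (Subset.∪-comm ⁅ j ⁆ ⁅ j′ ⁆) pair))
    exclusive {i} {j = j} {j′} i≢i′ (inj₁ (one , σj)) (inj₂ (_ , _ , unfit , _)) pair =
      unfit (i , one , Feasible-antitone (∪-monoˡ ⁅ j′ ⁆ (A₁-jobs σ one σj)) pair)
    exclusive {i′ = i′} {j} {j′} i≢i′ (inj₂ (_ , _ , unfit , _)) (inj₁ (one′ , σj′)) pair =
      unfit (i′ , one′ , Feasible-antitone (∪-monoˡ ⁅ j ⁆ (A₁-jobs σ one′ σj′))
        (subst Feasible (Subset.∪-comm ⁅ j ⁆ ⁅ j′ ⁆) pair))
    exclusive i≢i′ (inj₂ crit) (inj₂ crit′) = terminal₄ terminal i≢i′ crit crit′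

    -- Sending each machine of `L` to the machine of its exclusive job in `ρ` is injective: two such
    -- jobs on one machine of `ρ` would be a feasible pair.
    exclusive≤#machines : ∀ {ρ} → FeasibleAssignment ρ → ∀ {L} → Unique L →
                          (∀ {i} → i ∈ L → ∃[ j ] Exclusive i j) → length L ≤ #machines ρ
    exclusive≤#machines {ρ} feasible {L} L! excl with hosts L! excl
      where
      hosts : ∀ {L} → Unique L → (∀ {i} → i ∈ L → ∃[ j ] Exclusive i j) →
              ∃[ hs ] Unique hs × length hs ≡ length L
                × (∀ {h} → h ∈ hs → ∃[ i ] ∃[ j ] i ∈ L × Exclusive i j × ρ j ≡ h)
      hosts [] _ = [] , [] , refl , λ ()
      hosts {i ∷ L} (i∉L ∷ L!) excl
        with hs , hs! , len , from ← hosts L! (excl ∘ there) | j , j-excl ← excl (here refl) =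
        ρ j ∷ hs , ¬Any⇒All¬ _ apart ∷ hs! , cong suc len , λ where
          (here refl) → i , j , here refl , j-excl , refl
          (there h∈)  → let i′ , j′ , i′∈ , rest = from h∈ in i′ , j′ , there i′∈ , rest
        where
        apart : ρ j ∉ hs
        apart ρj∈ with i′ , j′ , i′∈ , j′-excl , ρj′ ← from ρj∈ =
          exclusive (All.lookup i∉L i′∈) j-excl j′-excl (Feasible-antitone
            (λ {k} k∈ → ∈-jobs⁺ ρ
              ([ cong ρ ∘ Subset.x∈⁅y⁆⇒x≡y j , (λ k∈ → trans (cong ρ (Subset.x∈⁅y⁆⇒x≡y j′ k∈)) ρj′) ]′
                (Subset.x∈p∪q⁻ ⁅ j ⁆ ⁅ j′ ⁆ k∈)))
            (feasible (ρ j) (j , refl)))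
    ... | hs , hs! , len , from = subst (_≤ #machines ρ) len (unique-⊆⇒length≤ hs! λ h∈ →
      let _ , j , _ , _ , ρj = from h∈ in ∈-machines⁺ (j , ρj))

    -- Operation (2) excludes that all jobs are good. If only `j` were not good, then by operation
    -- (3) it would fit in no machine of A₁ and the machine would be critical.
    two-bad : (∀ j → Dec (Good σ j)) → ∀ {i} → Medium σ i → ¬ Critical σ i →
              ∃[ j ] ∃[ k ] j ≢ k × (σ j ≡ i × ¬ Good σ j) × (σ k ≡ i × ¬ Good σ k)
    two-bad good? {i} medium ¬critical with any? (λ j → (σ j ℕ.≟ i) ×-dec ¬? (good? j))
    ... | no none = contradiction (λ j σj → decidable-stable (good? j) λ ¬good → none (j , σj , ¬good))
                      (terminal₂ terminal medium)
    ... | yes (j , σj , ¬good) with any? (λ k → ¬? (j Fin.≟ k) ×-dec (σ k ℕ.≟ i) ×-dec ¬? (good? k))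
    ...   | yes (k , j≢k , k-bad) = j , k , j≢k , (σj , ¬good) , k-bad
    ...   | no none = contradiction (j , medium , σj , terminal₃ terminal medium σj others , others) ¬critical
      where
      others : OthersGood σ i j
      others k σk k≢j = decidable-stable (good? k) λ ¬good → none (k , k≢j ∘ sym , σk , ¬good)

    -- A job that is not good fits in at most five machines of A₁; each of the others weighs at
    -- least `6 · Θ` less `weight j`, hence at least `y`.
    bad-bound : ∀ {L j y} → Unique L → (∀ {i} → i ∈ L → A₁ σ i) → ¬ A₁ σ (σ j) → ¬ Good σ j →
                0# ≼ y → y ⊕ weight j ≼ 6 · Θ → length L · y ≼ ∑∈L L (load σ) ⊕ 5 · y
    bad-bound {L} {j} {y} L! in-A₁ j∉S₁ bad 0≤y y+w≤6Θ = all-but (Fits σ j) 5 L! 0≤y (load-nonneg σ)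
      (λ {i} _ ¬fits → +-cancelʳ-≤ (weight j) (≤-trans y+w≤6Θ (misfit⇒≤ (jobs σ i) j ¬fits)))
      six
      where
      six : ¬ Many (Fits σ j) L 6
      six (ys@(_ ∷ _ ∷ _ ∷ _ ∷ _ ∷ _ ∷ []) , ys! , ys⊆ , fits , refl) =
        bad (j∉S₁ , mk↣ {to = List.lookup ys} (lookup-injective ys!) , λ k →
          in-A₁ (All.lookup ys⊆ (∈-lookup k)) , All.lookup fits (∈-lookup k))

-- The choice of the threshold and the bound on terminal assignments.

module Bound {c ℓ₁ ℓ₂ ℓ₃} {F : EuclideanField c ℓ₁ ℓ₂ ℓ₃} {N : ℕ} (I : SMBP F N) where
  open EuclideanFieldProperties F hiding (refl; sym; trans; _+_; _*_; _≤_; _<_)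
  open EuclideanField F using () renaming
    (_+_ to _⊕_; -_ to ⊖_; _≤_ to _≼_; _<_ to _≺_; refl to ≈-refl; sym to ≈-sym; trans to ≈-trans)
  open ListSums F
  open Combination F
  open LocalSearch I
  open SMBP I using (Feasible)
  open Weights I
  open LocalSearchProperties I
  open TerminalProperties I
  open Counting I
  private module R = CommutativeRing commutativeRing
  open ≤-Reasoning

  -- Each further job adds `t` on the left and 6 on the right. The base case is an equality in all
  -- uses: `t` is 5, 4 or 3 with `k` being 5, 2 or 1.
  t[1+n]≤6n : ∀ t {k n} → t ≤ 6 → t * suc k ≤ 6 * k → k ≤ n → t * suc n ≤ 6 * n
  t[1+n]≤6n t {k} {n} t≤6 base k≤n = lift (ℕ.≤⇒≤′ k≤n)
    where
    lift : ∀ {n} → k ℕ.≤′ n → t * suc n ≤ 6 * n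
    lift ℕ.≤′-refl = base
    lift (ℕ.≤′-step {n} k≤n) = ℕ.≤-trans (ℕ.≤-reflexive (ℕ.*-suc t (suc n)))
      (ℕ.≤-trans (ℕ.+-mono-≤ t≤6 (lift k≤n)) (ℕ.≤-reflexive (sym (ℕ.*-suc 6 n))))

  module _ {σ ρ : Assignment} (terminal : Terminal σ) (feasible : FeasibleAssignment ρ)
           (good? : ∀ j → Dec (Good σ j))
           (s₁ : Splitting (A₁ σ) (machines σ))
           (s₂ : Splitting (λ i → 5 ≤ ∣ jobs σ i ∣) (Splitting.outs s₁))
           (s₃ : Splitting (Critical σ) (Splitting.outs s₂)) where

    private
      module S₁ = Splitting s₁
      module S₂ = Splitting s₂
      module S₃ = Splitting s₃

    singles large critical others : List ℕ
    singles  = S₁.ins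
    large    = S₂.ins
    critical = S₃.ins
    others   = S₃.outs

    large-purchased : ∀ {i} → i ∈ large → Purchased σ i
    large-purchased = ∈-machines⁻ ∘ S₁.outs-⊆ ∘ S₂.ins-⊆

    medium : ∀ {i} → i ∈ S₂.outs → Medium σ i
    medium {i} i∈ with ∈-machines⁻ {σ} (S₁.outs-⊆ (S₂.outs-⊆ i∈))
    ... | j , σj = ℕ.≤∧≢⇒< (ℕ.n≢0⇒n>0 nonempty) (S₁.outs-¬P (S₂.outs-⊆ i∈) ∘ sym)
                 , ℕ.s≤s⁻¹ (ℕ.≰⇒> (S₂.outs-¬P i∈))
      where
      nonempty : ∣ jobs σ i ∣ ≢ 0
      nonempty ≡0 with () ← ℕ.≤-trans
        (unique-⊆⇒length≤ {xs = [ j ]} ([] ∷ []) (λ { (here refl) → ∈-jobList⁺ σ σj }))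
        (ℕ.≤-reflexive (trans (length-jobList σ i) ≡0))

    medium-purchased : ∀ {i} → i ∈ S₂.outs → Purchased σ i
    medium-purchased = ∈-machines⁻ ∘ S₁.outs-⊆ ∘ S₂.outs-⊆

    Bad : Fin N → Set ℓ₃
    Bad j = ¬ Good σ j × σ j ∈ others

    bad-not-single : ∀ {j} → Bad j → ¬ A₁ σ (σ j)
    bad-not-single (_ , σj∈) = Medium⇒¬A₁ σ (medium (S₃.outs-⊆ σj∈))

    others-load : ∀ {x} → (∀ j → Bad j → x ≼ weight j) → ∀ {i} → i ∈ others → x ⊕ x ≼ load σ i
    others-load x≤ {i} i∈ with two-bad terminal good? (medium (S₃.outs-⊆ i∈)) (S₃.outs-¬P i∈)
    ... | j , k , j≢k , (refl , j-bad) , (σk , k-bad) = ≤-trans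
      (+-mono-≤ (x≤ j (j-bad , i∈)) (x≤ k (k-bad , subst (_∈ others) (sym σk) i∈)))
      (∑∈-pair weight-nonneg j≢k (∈-jobs⁺ σ refl) (∈-jobs⁺ σ σk))

    0≤Θ : 0# ≼ Θ
    0≤Θ = <⇒≤ 0<Θ

    -- The thresholds of large and critical machines are fixed; those of A₁ and of the other medium
    -- machines, `y` and `z`, vary with `p` and `q`.
    bound-from : ∀ {p q y z} → 0# ≼ p → 0# ≼ q → Θ ≈ p ⊕ q → y ≈ 4 · p ⊕ 3 · q → z ≈ 4 · p ⊕ 6 · q →
                 length singles · y ≼ ∑∈L singles (load σ) ⊕ 5 · y →
                 length others · z ≼ ∑∈L others (load σ) ⊕ 1 · z →
                 #machines σ ≤ 2 * #machines ρ + 11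
    bound-from 0≤p 0≤q Θ≈ y≈ z≈ singles≤ others≤ = subst (_≤ 2 * #machines ρ + 11) (sym #≡)
      (counting 0≤p 0≤q 0<Θ Θ≈
        (length singles) (length large) (length critical) (length others) (#machines ρ)
        (rescale (length singles) 5 y≈ singles≤)
        (heavy terminal 5 S₂.ins-unique large-purchased
          (t[1+n]≤6n 5 {5} (ℕ.m≤m+n 5 1) ℕ.≤-refl ∘ S₂.ins-P))
        (heavy terminal 4 S₃.ins-unique (medium-purchased ∘ S₃.ins-⊆)
          (t[1+n]≤6n 4 {2} (ℕ.m≤m+n 4 2) ℕ.≤-refl ∘ proj₁ ∘ medium ∘ S₃.ins-⊆))
        (rescale (length others) 1 z≈ others≤)
        (≤-trans (≤-reflexive ∑≈) (≤-trans (≤-reflexive (∑load≈total σ)) (total≤ feasible)))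
        singles+critical≤)
      where
      #≡ : #machines σ ≡ length singles + (length large + (length critical + length others))
      #≡ = trans S₁.length-+ (cong (length singles +_)
             (trans S₂.length-+ (cong (length large +_) S₃.length-+)))
      ∑≈ : ∑∈L singles (load σ) ⊕ (∑∈L large (load σ) ⊕ (∑∈L critical (load σ) ⊕ ∑∈L others (load σ)))
         ≈ ∑∈L (machines σ) (load σ)
      ∑≈ = ≈-sym (≈-trans (S₁.∑-+ _) (R.+-congˡ (≈-trans (S₂.∑-+ _) (R.+-congˡ (S₃.∑-+ _)))))
      rescale : ∀ {x x′ w} n k → x ≈ x′ → n · x ≼ w ⊕ k · x → n · x′ ≼ w ⊕ k · x′
      rescale n k x≈ nx≤ = ≤-trans (≤-reflexive (×-congʳ n (≈-sym x≈)))
        (≤-trans nx≤ (≤-reflexive (R.+-congˡ (×-congʳ k x≈))))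
      singles+critical≤ : length singles + length critical ≤ #machines ρ
      singles+critical≤ = subst (_≤ #machines ρ) (length-++ singles)
        (exclusive≤#machines terminal feasible
          (Unique.++⁺ S₁.ins-unique S₃.ins-unique
            (λ (i∈₁ , i∈₃) → S₁.outs-¬P (S₂.outs-⊆ (S₃.ins-⊆ i∈₃)) (S₁.ins-P i∈₁)))
          λ i∈ → [ (λ i∈₁ → let j , σj = A₁⇒Purchased {σ} (S₁.ins-P i∈₁) in j , inj₁ (S₁.ins-P i∈₁ , σj))
                 , (λ i∈₃ → let j , crit = S₃.ins-P i∈₃ in j , inj₂ crit) ]′ (∈-++⁻ singles i∈))

    open Solver

    weaken : ∀ {n w x} k l → 0# ≼ x → k ≤ l → n · x ≼ w ⊕ k · x → n · x ≼ w ⊕ l · x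
    weaken k l 0≤x k≤l nx≤ = ≤-trans nx≤ (+-monoʳ-≤ _ (·-monoˡ-≤ 0≤x k≤l))

    others-bound : ∀ {x} → 0# ≼ x → (∀ j → Bad j → x ≼ weight j) →
                   length others · (x ⊕ x) ≼ ∑∈L others (load σ) ⊕ 1 · (x ⊕ x)
    -- No machine is exceptional here; one exception is granted to match `bound-from`.
    others-bound {x} 0≤x x≤ = weaken {length others} 0 1 (+-nonneg 0≤x 0≤x) z≤n
      (all-but (λ _ → Empty.⊥) 0 S₃.outs-unique (+-nonneg 0≤x 0≤x) (load-nonneg σ)
        (λ i∈ _ → others-load x≤ i∈) λ { (_ ∷ _ , _ , _ , () ∷ _ , _) })

    -- The endpoint `s` = 3/8, where `p` vanishes. The bound on A₁ comes from operation (1) rather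
    -- than from a bad job, so the case without bad jobs is included.
    bound-no-light-bad : (∀ j → Bad j → 3 · Θ ≼ weight j) → #machines σ ≤ 2 * #machines ρ + 11
    bound-no-light-bad 3Θ≤ = bound-from {0#} {Θ} {3 · Θ} {3 · Θ ⊕ 3 · Θ} ≤-refl 0≤Θ
      (≈-sym (R.+-identityˡ Θ))
      (solve 1 (λ θ → 3 :· θ := 4 :· (con 0) :+ 3 :· θ) ≈-refl Θ)
      (solve 1 (λ θ → 3 :· θ :+ 3 :· θ := 4 :· (con 0) :+ 6 :· θ) ≈-refl Θ)
      (weaken {length singles} 1 5 (·-nonneg 3 0≤Θ) (s≤s z≤n)
        (heavy terminal 3 S₁.ins-unique (∈-machines⁻ ∘ S₁.ins-⊆)
          (λ i∈ → t[1+n]≤6n 3 {1} (ℕ.m≤m+n 3 3) ℕ.≤-refl (ℕ.≤-reflexive (sym (S₁.ins-P i∈))))))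
      (others-bound (·-nonneg 3 0≤Θ) 3Θ≤)

    -- The endpoint `s` = ½, where `q` vanishes. The other medium machines are bounded by operation
    -- (1) rather than by their bad jobs.
    bound-light-bad : ∀ j → Bad j → weight j ≼ 2 · Θ → #machines σ ≤ 2 * #machines ρ + 11
    bound-light-bad j bad w≤2Θ = bound-from {Θ} {0#} {4 · Θ} {4 · Θ} 0≤Θ ≤-refl
      (≈-sym (R.+-identityʳ Θ))
      (solve 1 (λ θ → 4 :· θ := 4 :· θ :+ 3 :· (con 0)) ≈-refl Θ)
      (solve 1 (λ θ → 4 :· θ := 4 :· θ :+ 6 :· (con 0)) ≈-refl Θ)
      (bad-bound terminal S₁.ins-unique S₁.ins-P (bad-not-single bad) (proj₁ bad) (·-nonneg 4 0≤Θ)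
        (≤-trans (+-monoʳ-≤ _ w≤2Θ) (≤-reflexive (≈-sym (×-homo-+ Θ 4 2)))))
      (heavy terminal 4 S₃.outs-unique (medium-purchased ∘ S₃.outs-⊆)
        (t[1+n]≤6n 4 {2} (ℕ.m≤m+n 4 2) ℕ.≤-refl ∘ proj₁ ∘ medium ∘ S₃.outs-⊆))

    -- Here `p` and `q` are the distances of `x` from `3 · Θ` and `2 · Θ`. They add up to `Θ`, so
    -- that `x` is `2 p + 3 q` and `y` is `6 Θ - x`.
    bound-medium-bad : ∀ j → Bad j → (∀ k → Bad k → weight j ≼ weight k) →
                       2 · Θ ≼ weight j → weight j ≼ 3 · Θ → #machines σ ≤ 2 * #machines ρ + 11
    bound-medium-bad j bad least 2Θ≤x x≤3Θ = bound-from {p} {q} {y} {x ⊕ x} 0≤p 0≤q Θ≈p+q ≈-refl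
      (begin-equality
        x ⊕ x                                    ≈⟨ R.+-cong x≈ x≈ ⟩
        (2 · p ⊕ 3 · q) ⊕ (2 · p ⊕ 3 · q)        ≈⟨ solve 2 (λ p q →
           (2 :· p :+ 3 :· q) :+ (2 :· p :+ 3 :· q) := 4 :· p :+ 6 :· q) ≈-refl p q ⟩
        4 · p ⊕ 6 · q                            ∎)
      (bad-bound terminal S₁.ins-unique S₁.ins-P (bad-not-single bad) (proj₁ bad)
        (+-nonneg (·-nonneg 4 0≤p) (·-nonneg 3 0≤q))
        (≤-reflexive (begin-equality
          y ⊕ x                                  ≈⟨ R.+-congˡ x≈ ⟩
          y ⊕ (2 · p ⊕ 3 · q)                    ≈⟨ solve 2 (λ p q →
             (4 :· p :+ 3 :· q) :+ (2 :· p :+ 3 :· q) := 6 :· (p :+ q)) ≈-refl p q ⟩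
          6 · (p ⊕ q)                            ≈⟨ ×-congʳ 6 Θ≈p+q ⟨
          6 · Θ                                  ∎)))
      (others-bound (weight-nonneg j) least)
      where
      x p q y : Carrier
      x = weight j
      q = x ⊕ ⊖ (2 · Θ)
      p = 3 · Θ ⊕ ⊖ x
      y = 4 · p ⊕ 3 · q
      0≤p : 0# ≼ p
      0≤p = difference-nonneg x≤3Θ
      0≤q : 0# ≼ q
      0≤q = difference-nonneg 2Θ≤x
      Θ≈p+q : Θ ≈ p ⊕ q
      Θ≈p+q = +-cancelʳ (2 · Θ) Θ (p ⊕ q) (begin-equality
        3 · Θ               ≈⟨ difference x (3 · Θ) ⟨
        p ⊕ x               ≈⟨ R.+-congˡ (difference (2 · Θ) x) ⟨
        p ⊕ (q ⊕ 2 · Θ)     ≈⟨ R.+-assoc p q (2 · Θ) ⟨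
        p ⊕ q ⊕ 2 · Θ       ∎)
      x≈ : x ≈ 2 · p ⊕ 3 · q
      x≈ = begin-equality
        x                   ≈⟨ difference (2 · Θ) x ⟨
        q ⊕ 2 · Θ           ≈⟨ R.+-congˡ (×-congʳ 2 Θ≈p+q) ⟩
        q ⊕ 2 · (p ⊕ q)     ≈⟨ solve 2 (λ p q → q :+ 2 :· (p :+ q) := 2 :· p :+ 3 :· q) ≈-refl p q ⟩
        2 · p ⊕ 3 · q       ∎

  -- Inequality of naturals is stable, so excluded middle for `Good`, the three splittings and a
  -- least bad job are available under double negation.
  terminal-bound : ∀ {σ ρ} → Terminal σ → FeasibleAssignment ρ → #machines σ ≤ 2 * #machines ρ + 11
  terminal-bound {σ} {ρ} terminal feasible = decidable-stable (_ ℕ.≤? _) λ exceeds →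
    sequence (RawMonad.rawApplicative ¬¬-Monad) (λ j → ¬¬-excluded-middle {A = Good σ j}) λ good? →
    ¬¬-split (A₁ σ) (machines-unique σ) λ s₁ →
    ¬¬-split (λ i → 5 ≤ ∣ jobs σ i ∣) (Splitting.outs-unique s₁) λ s₂ →
    ¬¬-split (Critical σ) (Splitting.outs-unique s₂) λ s₃ →
    ¬¬-min (Bad terminal feasible good? s₁ s₂ s₃) weight λ where
      (inj₁ none) → exceeds (bound-no-light-bad terminal feasible good? s₁ s₂ s₃
        λ j bad → contradiction bad (none j))
      (inj₂ (j , bad , least)) → ≤-total {weight j} {2 · Θ} λ where
        (inj₁ w≤2Θ) → exceeds (bound-light-bad terminal feasible good? s₁ s₂ s₃ j bad w≤2Θ)
        (inj₂ 2Θ≤w) → ≤-total {weight j} {3 · Θ} λ where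
          (inj₁ w≤3Θ) → exceeds (bound-medium-bad terminal feasible good? s₁ s₂ s₃ j bad least 2Θ≤w w≤3Θ)
          (inj₂ 3Θ≤w) → exceeds (bound-no-light-bad terminal feasible good? s₁ s₂ s₃
            λ k k-bad → ≤-trans 3Θ≤w (least k k-bad))

theorem6 : ∀ {c ℓ₁ ℓ₂ ℓ₃} (F : EuclideanField c ℓ₁ ℓ₂ ℓ₃) (N : ℕ) (I : SMBP F N) →
    let open LocalSearch I in
    ∀ σ₀ → FeasibleAssignment σ₀ →
    (∀ n σ → Run n σ₀ σ → n ≤ N ^ 3)
    × (∀ n σ → Run n σ₀ σ → Terminal σ →
    FeasibleAssignment σ × (∀ OPT → IsOPT OPT → #machines σ ≤ 2 * OPT + 11))
theorem6 F N I σ₀ feasible =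
    (λ n σ → Run-length)
  , λ n σ run terminal → Run-feasible run feasible , λ where
      OPT ((ρ , ρ-feasible , refl) , _) → terminal-bound terminal ρ-feasible
  where
  open LocalSearchProperties I
  open Bound I
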